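{- Let $k\ge 1$ be a fixed integer. The number of rectangular alternating sign matrices of size $k\times n$, for integers $n\ge k$, is given by a polynomial in $n$ of degree $\binom{k+1}{2}$ with leading coefficient $\prod_{i=0}^{k-1}\frac{(2i)!}{(k+i)!}$.
   Context: For $k\le n$, a (rectangular) alternating sign matrix of size $k\times n$ is a $k\times n$ matrix with entries in $\{ -1,0,1\}$ such that: in each row and each column the non-zero entries alternate in sign; the leftmost non-zero entry in every row and the bottommost non-zero entry in every column (if any) is $1$; there are no zero rows, and the rightmost non-zero entry in every row is $1$; and, if $k=n$, additionally there are no zero columns and the topmost non-zero entry in every column is $1$. -}

module Defs where

open import Data.Fin.Base using (Fin)
open import Data.Integer.Base using (ℤ; +_; 0ℤ; 1ℤ; -1ℤ; sign)
import Data.Integer.Properties as ℤ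
open import Data.List.Base as List using (List; []; _∷_)
open import Data.List.Membership.Propositional using (_∈_)
open import Data.List.Relation.Unary.Linked using (Linked)
open import Data.List.Relation.Unary.Unique.Propositional using (Unique)
import Data.Maybe.Relation.Unary.All as MaybeAll
open import Data.Nat.Base as ℕ using (ℕ; zero; suc; _!)
open import Data.Nat.Properties using (_!≢0)
open import Data.Product.Base using (_×_; ∃-syntax)
open import Data.Rational.Base using (ℚ; 0ℚ; 1ℚ; _+_; _*_; _/_)
open import Data.Vec.Base as Vec using (Vec)
import Data.Vec.Relation.Unary.All as VecAll
open import Function.Bundles using (_⇔_)
open import Relation.Binary.PropositionalEquality using (_≡_; _≢_)
open import Relation.Nullary using (¬_; ¬?)

-- Rows are listed from top to bottom and the entries of a row from left to
-- right, so "leftmost" and "topmost" mean first, "rightmost" and "bottommost"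
-- mean last.

Matrix : ℕ → ℕ → Set
Matrix k n = Vec (Vec ℤ n) k

row : ∀ {k n} → Matrix k n → Fin k → Vec ℤ n
row M i = Vec.lookup M i

column : ∀ {k n} → Matrix k n → Fin n → Vec ℤ k
column M j = Vec.map (λ r → Vec.lookup r j) M

nonZeros : ∀ {m} → Vec ℤ m → List ℤ
nonZeros v = List.filter (λ x → ¬? (x ℤ.≟ 0ℤ)) (Vec.toList v)

IsZero : ∀ {m} → Vec ℤ m → Set
IsZero = VecAll.All (_≡ 0ℤ)

AlternatesInSign : ∀ {m} → Vec ℤ m → Set
AlternatesInSign v = Linked (λ x y → sign x ≢ sign y) (nonZeros v)

-- Both hold vacuously for a zero vector.

FirstNonZeroIs1 : ∀ {m} → Vec ℤ m → Set
FirstNonZeroIs1 v = MaybeAll.All (_≡ 1ℤ) (List.head (nonZeros v))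

LastNonZeroIs1 : ∀ {m} → Vec ℤ m → Set
LastNonZeroIs1 v = MaybeAll.All (_≡ 1ℤ) (List.last (nonZeros v))

record IsASM {k n : ℕ} (M : Matrix k n) : Set where
  field
    entries           : ∀ i j → Vec.lookup (row M i) j ∈ -1ℤ ∷ 0ℤ ∷ 1ℤ ∷ []
    rows-alternate    : ∀ i → AlternatesInSign (row M i)
    columns-alternate : ∀ j → AlternatesInSign (column M j)
    row-leftmost      : ∀ i → FirstNonZeroIs1 (row M i)
    column-bottommost : ∀ j → LastNonZeroIs1 (column M j)
    row-nonzero       : ∀ i → ¬ IsZero (row M i)
    row-rightmost     : ∀ i → LastNonZeroIs1 (row M i)
    column-nonzero    : k ≡ n → ∀ j → ¬ IsZero (column M j)
    column-topmost    : k ≡ n → ∀ j → FirstNonZeroIs1 (column M j)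

NumberOf : {A : Set} → (A → Set) → ℕ → Set
NumberOf P N = ∃[ xs ] (Unique xs × (∀ x → x ∈ xs ⇔ P x) × List.length xs ≡ N)

-- A polynomial in one variable over ℚ, as its list of coefficients, constant
-- term first; trailing zeros are allowed.

Polynomial : Set
Polynomial = List ℚ

coeff : Polynomial → ℕ → ℚ
coeff []      _       = 0ℚ
coeff (c ∷ p) zero    = c
coeff (c ∷ p) (suc i) = coeff p i

eval : Polynomial → ℚ → ℚ
eval []      x = 0ℚ
eval (c ∷ p) x = c + x * eval p x

record HasDegree (p : Polynomial) (d : ℕ) : Set where
  field
    coeff-d≢0 : coeff p d ≢ 0ℚ
    coeff>d≡0 : ∀ i → d ℕ.< i → coeff p i ≡ 0ℚ

fromℕ : ℕ → ℚ
fromℕ n = + n / 1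

∏ : ℕ → (ℕ → ℚ) → ℚ
∏ m f = List.foldr _*_ 1ℚ (List.applyUpTo f m)

_!/_! : ℕ → ℕ → ℚ
a !/ b ! = (+ (a !) / (b !)) {{b !≢0}}

{-# OPTIONS --safe #-}
module Submission where

-- Read a k × n matrix column by column and record, in a vector of k bits, the
-- partial sums of its rows. The matrix is an ASM exactly when this is an n-step
-- walk from 00…0 to 11…1 whose steps are alternating columns ending in 1. Let
-- the weight of a state be the sum of the positions, counted from the top, of
-- its zeros. The zero column fixes every state and any other column lowers the
-- weight, so the number of walks is Σ_m s_m C(n,m) with s_m the number of m-step
-- walks avoiding the zero column, and s_m = 0 for m greater than the initial
-- weight N = C(k+1,2). The walks counted by s_N lower the weight by one at each
-- step: read on the set of positions of zeros, they remove the cells of the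
-- shifted staircase (k,…,2,1) one at a time. Their number is given by the hook
-- formula for shifted standard tableaux, whose recursion is a partial fraction
-- identity, and s_N / N! is the leading coefficient.

open import Defs
open import Data.Bool.Base using (Bool; true; false)
open import Data.Empty using (⊥-elim)
open import Data.Fin.Base using (Fin; zero; suc)
open import Data.Integer.Base as ℤ using (ℤ; 0ℤ; 1ℤ; -1ℤ)
import Data.Integer.Properties as ℤ
open import Data.List.Base as List using (List; []; _∷_; _++_)
open import Data.List.Membership.Propositional using (_∈_)
open import Data.List.Membership.Propositional.Properties using (∈-map⁺; ∈-map⁻; ∈-++⁺ˡ; ∈-++⁺ʳ; ∈-++⁻)
open import Data.List.Properties using (length-map; length-++)
open import Data.List.Relation.Unary.All as All using (All; []; _∷_)
open import Data.List.Relation.Unary.AllPairs using (AllPairs; []; _∷_)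
open import Data.List.Relation.Unary.Any using (here; there)
open import Data.List.Relation.Unary.Linked as Linked using ([]; [-]; _∷_)
import Data.List.Relation.Unary.Unique.Propositional.Properties as Unique
open import Data.Maybe.Relation.Unary.All as MaybeAll using (just; nothing)
open import Data.Nat.Base as ℕ using (ℕ; zero; suc; pred; _≤_; _<_; z≤n; s≤s; NonZero; _!)
open import Data.Nat.Combinatorics using (_C_; nC1≡n; nCk+nC[k+1]≡[n+1]C[k+1]; k>n⇒nCk≡0)
open import Data.Nat.ListAction using (sum)
import Data.Nat.Properties as ℕ
open import Data.Nat.Tactic.RingSolver using () renaming (solve-∀ to ℕ-solve-∀)
open import Data.Product.Base using (_×_; _,_; ∃-syntax; proj₁; proj₂; uncurry)
open import Data.Rational.Base using (ℚ; 0ℚ; 1ℚ; _+_; _*_; _-_; -_; 1/_; _/_; toℚᵘ; fromℚᵘ; ≢-nonZero)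
import Data.Rational.Properties as ℚ
import Data.Rational.Unnormalised.Base as ℚᵘ
import Data.Rational.Unnormalised.Properties as ℚᵘ
open import Data.Sum.Base using (_⊎_; inj₁; inj₂)
open import Data.Vec.Base as Vec using (Vec; []; _∷_; lookup; replicate; zipWith)
import Data.Vec.Properties as Vec
open import Data.Vec.Relation.Binary.Pointwise.Inductive using (Pointwise; []; _∷_)
open import Data.Vec.Relation.Unary.All using ([]; _∷_)
open import Function.Base using (_∘_; case_of_)
open import Function.Bundles using (mk⇔; Equivalence)
open import Level using (0ℓ)
open import Relation.Binary.PropositionalEquality
open import Relation.Nullary using (¬_; yes; no; contradiction)
open import Relation.Nullary.Decidable using (dec⇒maybe)
open import Tactic.RingSolver using (solve-∀)
open import Tactic.RingSolver.Core.AlmostCommutativeRing using (AlmostCommutativeRing; fromCommutativeRing)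

-- Why a non-zero column lowers the weight: each -1 creates a zero, and the next non-zero entry
-- below it is a 1 that removes a zero at a larger position; a leading 1 removes a zero without any
-- compensation. A drop of exactly one leaves only a single 1 in the top row, or a -1 immediately
-- above a 1. In terms of parts, one part decreases by 1. Of the numbers s_m only the vanishing
-- beyond N and the top value s_N are ever determined; the others enter the polynomial as unknown
-- coefficients. A decrement may collide with the next smaller part or reach 0. Instead of excluding
-- these cases, the hook product is taken over arbitrary lists: it vanishes at a collision and
-- ignores a part 0, so the recursion runs over all parts alike. Dividing it by the undecremented
-- product turns the recursion into the statement that the residues of a rational function, with
-- poles at x(x-1) and zeros at x(x+1), add up to -2 times the sum of the parts.

private variable
  k m n : ℕ
  A B : Set
  c s : Bool
  v : Vec ℤ m

-- Counting

NumberOf-none : {P : A → Set} → (∀ x → ¬ P x) → NumberOf P 0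
NumberOf-none ¬P = [] , [] , (λ x → mk⇔ (λ ()) (⊥-elim ∘ ¬P x)) , refl

NumberOf-one : {P : A → Set} (a : A) → P a → (∀ x → P x → x ≡ a) → NumberOf P 1
NumberOf-one a Pa unique =
  a ∷ [] , [] ∷ []
  , (λ x → mk⇔ (λ { (here refl) → Pa }) (here ∘ unique x)) , refl

NumberOf-⇔ : {P Q : A → Set} {N : ℕ} →
             (∀ x → P x → Q x) → (∀ x → Q x → P x) → NumberOf P N → NumberOf Q N
NumberOf-⇔ P⇒Q Q⇒P (xs , unique , complete , length≡) =
  xs , unique
  , (λ x → mk⇔ (P⇒Q x ∘ Equivalence.to (complete x)) (Equivalence.from (complete x) ∘ Q⇒P x))
  , length≡

NumberOf-image : {P : A → Set} {Q : B → Set} {N : ℕ} (f : A → B) →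
                 (∀ {x y} → f x ≡ f y → x ≡ y) →
                 (∀ x → P x → Q (f x)) → (∀ y → Q y → ∃[ x ] (P x × y ≡ f x)) →
                 NumberOf P N → NumberOf Q N
NumberOf-image {P = P} {Q} f injective to from (xs , unique , complete , length≡) =
  List.map f xs , Unique.map⁺ injective unique
  , (λ y → mk⇔ (λ y∈ → sound y∈) (λ Qy → covers y Qy)) , trans (length-map f xs) length≡
  where
  sound : ∀ {y} → y ∈ List.map f xs → Q y
  sound y∈ with ∈-map⁻ f y∈
  ... | x , x∈ , refl = to x (Equivalence.to (complete x) x∈)

  covers : ∀ y → Q y → y ∈ List.map f xs
  covers y Qy with from y Qy
  ... | x , Px , refl = ∈-map⁺ f (Equivalence.from (complete x) Px)

NumberOf-⊎ : {P Q : A → Set} {M N : ℕ} → (∀ x → P x → ¬ Q x) →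
             NumberOf P M → NumberOf Q N → NumberOf (λ x → P x ⊎ Q x) (M ℕ.+ N)
NumberOf-⊎ {P = P} {Q} disjoint (xs , xs! , P⇔ , |xs|) (ys , ys! , Q⇔ , |ys|) =
  xs List.++ ys
  , Unique.++⁺ xs! ys! (λ { {x} (x∈xs , x∈ys) →
      disjoint x (Equivalence.to (P⇔ x) x∈xs) (Equivalence.to (Q⇔ x) x∈ys) })
  , (λ x → mk⇔ (sound x) (covers x))
  , trans (length-++ xs) (cong₂ ℕ._+_ |xs| |ys|)
  where
  sound : ∀ x → x ∈ xs List.++ ys → P x ⊎ Q x
  sound x x∈ with ∈-++⁻ xs x∈
  ... | inj₁ x∈xs = inj₁ (Equivalence.to (P⇔ x) x∈xs)
  ... | inj₂ x∈ys = inj₂ (Equivalence.to (Q⇔ x) x∈ys)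

  covers : ∀ x → P x ⊎ Q x → x ∈ xs List.++ ys
  covers x (inj₁ Px) = ∈-++⁺ˡ (Equivalence.from (P⇔ x) Px)
  covers x (inj₂ Qx) = ∈-++⁺ʳ xs (Equivalence.from (Q⇔ x) Qx)

-- Alternating vectors

-- The Boolean is the state (0 or 1) to which the entries are added one at a
-- time: all partial sums stay in {0,1} and the last one is 1.

data Alternating : Bool → Vec ℤ m → Set where
  []  : Alternating true []
  keep : Alternating s v → Alternating s (0ℤ ∷ v)
  up : Alternating true v → Alternating false (1ℤ ∷ v)
  down : Alternating false v → Alternating true (-1ℤ ∷ v)

-- The starting state is determined by the sum of the entries: 1 for `false`, 0 for `true`. This
-- keeps the two kinds of columns disjoint when they are counted.
Alternating-functional : Alternating c v → Alternating s v → c ≡ s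
Alternating-functional []       []       = refl
Alternating-functional (keep p) (keep q) = Alternating-functional p q
Alternating-functional (up _)   (up _)   = refl
Alternating-functional (down _) (down _) = refl

Alternating-entries : Alternating s v → ∀ i → lookup v i ∈ -1ℤ ∷ 0ℤ ∷ 1ℤ ∷ []
Alternating-entries (keep p) zero    = there (here refl)
Alternating-entries (up p)   zero    = there (there (here refl))
Alternating-entries (down p) zero    = here refl
Alternating-entries (keep p) (suc i) = Alternating-entries p i
Alternating-entries (up p)   (suc i) = Alternating-entries p i
Alternating-entries (down p) (suc i) = Alternating-entries p i

nonZeros-false : Alternating false v → ∃[ l ] nonZeros v ≡ 1ℤ ∷ l
nonZeros-false (keep p) = nonZeros-false p
nonZeros-false (up p)   = _ , refl

nonZeros-true : Alternating true v → (nonZeros v ≡ [] × IsZero v) ⊎ (∃[ l ] nonZeros v ≡ -1ℤ ∷ l)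
nonZeros-true []       = inj₁ (refl , [])
nonZeros-true (down p) = inj₂ (_ , refl)
nonZeros-true (keep p) with nonZeros-true p
... | inj₁ (eq , z) = inj₁ (eq , refl ∷ z)
... | inj₂ p′       = inj₂ p′

Alternating-nonzero : Alternating false v → ¬ IsZero v
Alternating-nonzero (keep p) (_ ∷ z) = Alternating-nonzero p z
Alternating-nonzero (up p)   (() ∷ _)

Alternating-first : Alternating false v → FirstNonZeroIs1 v
Alternating-first p rewrite proj₂ (nonZeros-false p) = just refl

Alternating-last : Alternating s v → LastNonZeroIs1 v
Alternating-last [] = nothing
Alternating-last (keep p) = Alternating-last p
Alternating-last (up {v = v} p) with nonZeros v | nonZeros-true p | Alternating-last p
... | .[]      | inj₁ (refl , _) | _ = just refl
... | .(_ ∷ _) | inj₂ (_ , refl) | q = q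
Alternating-last (down {v = v} p) with nonZeros v | nonZeros-false p | Alternating-last p
... | .(_ ∷ _) | _ , refl | q = q

Alternating-signs : Alternating s v → AlternatesInSign v
Alternating-signs [] = []
Alternating-signs (keep p) = Alternating-signs p
Alternating-signs (up {v = v} p) with nonZeros v | nonZeros-true p | Alternating-signs p
... | .[]      | inj₁ (refl , _) | _ = [-]
... | .(_ ∷ _) | inj₂ (_ , refl) | q = (λ ()) ∷ q
Alternating-signs (down {v = v} p) with nonZeros v | nonZeros-false p | Alternating-signs p
... | .(_ ∷ _) | _ , refl | q = (λ ()) ∷ q

last-tail : ∀ x l → MaybeAll.All (_≡ 1ℤ) (List.last (x ∷ l)) → MaybeAll.All (_≡ 1ℤ) (List.last l)
last-tail x []      _ = nothing
last-tail x (_ ∷ _) q = q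

-- The state is found from the last entry backwards. A tail in state `true` is zero or starts with
-- -1, so a -1 in front of it would be the last non-zero entry or break alternation; a tail in state
-- `false` starts with 1, so a 1 in front of it would break alternation.
alternating : (v : Vec ℤ m) → (∀ i → lookup v i ∈ -1ℤ ∷ 0ℤ ∷ 1ℤ ∷ []) →
              AlternatesInSign v → LastNonZeroIs1 v → ∃[ s ] Alternating s v
alternating [] entries signs last = true , []
alternating (x ∷ v) entries signs last with entries zero
... | there (here refl) =
  let s , p = alternating v (entries ∘ suc) signs last in s , keep p
... | here refl with alternating v (entries ∘ suc) (Linked.tail signs) (last-tail -1ℤ (nonZeros v) last)
...   | false , p = true , down p
...   | true  , p with nonZeros v | nonZeros-true p | signs | last
...     | .[]      | inj₁ (refl , _) | _       | just ()
...     | .(_ ∷ _) | inj₂ (_ , refl) | -≢- ∷ _ | _ = contradiction refl -≢-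
alternating (x ∷ v) entries signs last | there (there (here refl))
  with alternating v (entries ∘ suc) (Linked.tail signs) (last-tail 1ℤ (nonZeros v) last)
... | true  , p = false , up p
... | false , p with nonZeros v | nonZeros-false p | signs
...   | .(_ ∷ _) | _ , refl | +≢+ ∷ _ = contradiction refl +≢+

alternating-false : (v : Vec ℤ m) → (∀ i → lookup v i ∈ -1ℤ ∷ 0ℤ ∷ 1ℤ ∷ []) →
                    AlternatesInSign v → FirstNonZeroIs1 v → LastNonZeroIs1 v → ¬ IsZero v →
                    Alternating false v
alternating-false v entries signs first last nonzero with alternating v entries signs last
... | false , p = p
... | true  , p with nonZeros v | nonZeros-true p | first
...   | .[]      | inj₁ (refl , z) | _ = contradiction z nonzero
...   | .(_ ∷ _) | inj₂ (_ , refl) | just ()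

-- Matrices column by column

-- Step c bs v bs′ says that v, alternating from the state c, takes the row
-- states bs to bs′. Both states change at a non-zero entry, so such an entry
-- needs them to be equal.

data Step : Bool → Vec Bool k → Vec ℤ k → Vec Bool k → Set where
  []   : Step true [] [] []
  keep : ∀ {b} {bs : Vec Bool k} {v bs′} → Step c bs v bs′ → Step c (b ∷ bs) (0ℤ ∷ v) (b ∷ bs′)
  up   : {bs : Vec Bool k} → ∀ {v bs′} → Step true bs v bs′ → Step false (false ∷ bs) (1ℤ ∷ v) (true ∷ bs′)
  down : {bs : Vec Bool k} → ∀ {v bs′} → Step false bs v bs′ → Step true (true ∷ bs) (-1ℤ ∷ v) (false ∷ bs′)

_∷ᶜ_ : Vec ℤ k → Matrix k n → Matrix k (suc n)
_∷ᶜ_ = zipWith _∷_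

column-zero : (v : Vec ℤ k) (M : Matrix k n) → column (v ∷ᶜ M) zero ≡ v
column-zero []      []      = refl
column-zero (x ∷ v) (r ∷ M) = cong (x ∷_) (column-zero v M)

column-suc : (v : Vec ℤ k) (M : Matrix k n) (j : Fin n) → column (v ∷ᶜ M) (suc j) ≡ column M j
column-suc []      []      j = refl
column-suc (x ∷ v) (r ∷ M) j = cong (lookup r j ∷_) (column-suc v M j)

∷ᶜ-injective : {vM wN : Vec ℤ k × Matrix k n} → uncurry _∷ᶜ_ vM ≡ uncurry _∷ᶜ_ wN → vM ≡ wN
∷ᶜ-injective {vM = []    , []}    {[]    , []}    eq = refl
∷ᶜ-injective {vM = x ∷ v , r ∷ M} {y ∷ w , s ∷ N} eq
  with refl ← cong (Vec.head ∘ Vec.head) eq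
     | refl ← cong (Vec.tail ∘ Vec.head) eq
     | refl ← ∷ᶜ-injective {vM = v , M} {w , N} (cong Vec.tail eq) = refl

∷ᶜ-surjective : (M : Matrix k (suc n)) → ∃[ v ] ∃[ N ] M ≡ v ∷ᶜ N
∷ᶜ-surjective [] = [] , [] , refl
∷ᶜ-surjective ((x ∷ r) ∷ M) with ∷ᶜ-surjective M
... | v , N , refl = x ∷ v , r ∷ N , refl

Rows : Vec Bool k → Matrix k n → Set
Rows = Pointwise (λ s → Alternating s)

Step⇒Alternating : {bs bs′ : Vec Bool k} → Step c bs v bs′ → Alternating c v
Step⇒Alternating []       = []
Step⇒Alternating (keep p) = keep (Step⇒Alternating p)
Step⇒Alternating (up p)   = up (Step⇒Alternating p)
Step⇒Alternating (down p) = down (Step⇒Alternating p)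

Step⇒Rows : {bs bs′ : Vec Bool k} {M : Matrix k n} → Step c bs v bs′ → Rows bs′ M → Rows bs (v ∷ᶜ M)
Step⇒Rows []       []       = []
Step⇒Rows (keep p) (r ∷ rs) = keep r ∷ Step⇒Rows p rs
Step⇒Rows (up p)   (r ∷ rs) = up r ∷ Step⇒Rows p rs
Step⇒Rows (down p) (r ∷ rs) = down r ∷ Step⇒Rows p rs

Rows⇒Step : (bs : Vec Bool k) (M : Matrix k n) → Rows bs (v ∷ᶜ M) → Alternating c v →
            ∃[ bs′ ] (Step c bs v bs′ × Rows bs′ M)
Rows⇒Step [] [] [] [] = [] , [] , []
Rows⇒Step (b ∷ bs) (r ∷ M) (keep q ∷ rs) (keep p) =
  let bs′ , st , rs′ = Rows⇒Step bs M rs p in b ∷ bs′ , keep st , q ∷ rs′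
Rows⇒Step (b ∷ bs) (r ∷ M) (up q ∷ rs) (up p) =
  let bs′ , st , rs′ = Rows⇒Step bs M rs p in true ∷ bs′ , up st , q ∷ rs′
Rows⇒Step (b ∷ bs) (r ∷ M) (down q ∷ rs) (down p) =
  let bs′ , st , rs′ = Rows⇒Step bs M rs p in false ∷ bs′ , down st , q ∷ rs′

-- The part of a matrix to the right of a cut, `bs` being the row sums to the left of it. The state
-- of a column is left free: `false` for column sum 1, `true` for column sum 0.
Completes : Vec Bool k → Matrix k n → Set
Completes bs M = Rows bs M × (∀ j → ∃[ c ] Alternating c (column M j))

StepCompletes : Bool → Vec Bool k → Vec ℤ k × Matrix k n → Set
StepCompletes c bs (v , M) = ∃[ bs′ ] (Step c bs v bs′ × Completes bs′ M)

Completes-∷ᶜ⁺ : {bs : Vec Bool k} {M : Matrix k n} → StepCompletes c bs (v , M) → Completes bs (v ∷ᶜ M)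
Completes-∷ᶜ⁺ {c = c} {v = v} {M = M} (bs′ , st , rows , columns) = Step⇒Rows st rows , λ where
  zero    → c , subst (Alternating c) (sym (column-zero v M)) (Step⇒Alternating st)
  (suc j) → let c′ , p = columns j in c′ , subst (Alternating c′) (sym (column-suc v M j)) p

Completes-∷ᶜ⁻ : {bs : Vec Bool k} {v : Vec ℤ k} {M : Matrix k n} → Completes bs (v ∷ᶜ M) →
                ∃[ c ] StepCompletes c bs (v , M)
Completes-∷ᶜ⁻ {bs = bs} {v} {M} (rows , columns) with columns zero
... | c , p with Rows⇒Step bs M rows (subst (Alternating c) (column-zero v M) p)
...   | bs′ , st , rows′ = c , bs′ , st , rows′ , λ j →
  let c′ , q = columns (suc j) in c′ , subst (Alternating c′) (column-suc v M j) q

ΣStep : Bool → Vec Bool k → (Vec Bool k → ℕ) → ℕ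
ΣStep true  []           F = F []
ΣStep false []           F = 0
ΣStep true  (true  ∷ bs) F = ΣStep true  bs (F ∘ (true  ∷_)) ℕ.+ ΣStep false bs (F ∘ (false ∷_))
ΣStep true  (false ∷ bs) F = ΣStep true  bs (F ∘ (false ∷_))
ΣStep false (true  ∷ bs) F = ΣStep false bs (F ∘ (true  ∷_))
ΣStep false (false ∷ bs) F = ΣStep false bs (F ∘ (false ∷_)) ℕ.+ ΣStep true  bs (F ∘ (true  ∷_))

-- At each position the possible entries differ, so the branches are disjoint. `P` and `F` are
-- arbitrary families over the target state because the recursion fixes its first bit and passes on
-- `P ∘ (b′ ∷_)`; `y` carries the remaining columns.
NumberOf-Step : (P : Vec Bool k → B → Set) (F : Vec Bool k → ℕ) → (∀ bs → NumberOf (P bs) (F bs)) →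
                ∀ c bs → NumberOf {Vec ℤ k × B} (λ (v , y) → ∃[ bs′ ] (Step c bs v bs′ × P bs′ y))
                                  (ΣStep c bs F)
NumberOf-Step P F count true [] =
  NumberOf-image ([] ,_) (cong proj₂) (λ y Py → [] , [] , Py)
    (λ { ([] , y) ([] , [] , Py) → y , Py , refl }) (count [])
NumberOf-Step P F count false [] = NumberOf-none λ { _ (_ , () , _) }
NumberOf-Step {suc k} {B} P F count c (b ∷ bs) = go c b
  where
  cons : ℤ → Vec ℤ k × B → Vec ℤ (suc k) × B
  cons x (v , y) = x ∷ v , y

  cons-injective : ∀ {x} {p q : Vec ℤ k × B} → cons x p ≡ cons x q → p ≡ q
  cons-injective refl = refl

  tailed : ∀ x b′ c′ → NumberOf (λ (w , y) → ∃[ v ] (w ≡ x ∷ v × ∃[ bs′ ] (Step c′ bs v bs′ × P (b′ ∷ bs′) y)))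
                                 (ΣStep c′ bs (F ∘ (b′ ∷_)))
  tailed x b′ c′ = NumberOf-image (cons x) cons-injective
    (λ { (v , y) p → v , refl , p }) (λ { (.(x ∷ v) , y) (v , refl , p) → (v , y) , p , refl })
    (NumberOf-Step (P ∘ (b′ ∷_)) (F ∘ (b′ ∷_)) (count ∘ (b′ ∷_)) c′ bs)

  go : ∀ c b → NumberOf (λ (v , y) → ∃[ bs′ ] (Step c (b ∷ bs) v bs′ × P bs′ y)) (ΣStep c (b ∷ bs) F)
  go true false = NumberOf-⇔
    (λ { _ (_ , refl , _ , st , p) → _ , keep st , p })
    (λ { _ (_ , keep st , p) → _ , refl , _ , st , p })
    (tailed 0ℤ false true)
  go false true = NumberOf-⇔
    (λ { _ (_ , refl , _ , st , p) → _ , keep st , p })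
    (λ { _ (_ , keep st , p) → _ , refl , _ , st , p })
    (tailed 0ℤ true false)
  go true true = NumberOf-⇔
    (λ { _ (inj₁ (_ , refl , _ , st , p)) → _ , keep st , p
       ; _ (inj₂ (_ , refl , _ , st , p)) → _ , down st , p })
    (λ { _ (_ , keep st , p) → inj₁ (_ , refl , _ , st , p)
       ; _ (_ , down st , p) → inj₂ (_ , refl , _ , st , p) })
    (NumberOf-⊎ (λ { _ (_ , refl , _) (_ , () , _) }) (tailed 0ℤ true true) (tailed -1ℤ false false))
  go false false = NumberOf-⇔
    (λ { _ (inj₁ (_ , refl , _ , st , p)) → _ , keep st , p
       ; _ (inj₂ (_ , refl , _ , st , p)) → _ , up st , p })
    (λ { _ (_ , keep st , p) → inj₁ (_ , refl , _ , st , p)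
       ; _ (_ , up st , p) → inj₂ (_ , refl , _ , st , p) })
    (NumberOf-⊎ (λ { _ (_ , refl , _) (_ , () , _) }) (tailed 0ℤ false false) (tailed 1ℤ true true))

isFull : Vec Bool k → ℕ
isFull []           = 1
isFull (true  ∷ bs) = isFull bs
isFull (false ∷ bs) = 0

completions : ℕ → Vec Bool k → ℕ
completions zero    bs = isFull bs
completions (suc n) bs = ΣStep false bs (completions n) ℕ.+ ΣStep true bs (completions n)

Rows-unique : (bs : Vec Bool k) → NumberOf (Rows {n = 0} bs) (isFull bs)
Rows-unique [] = NumberOf-one [] [] (λ { [] _ → refl })
Rows-unique (true ∷ bs) = NumberOf-image ([] ∷_) Vec.∷-injectiveʳ (λ M rs → [] ∷ rs)
  (λ { (.[] ∷ M) ([] ∷ rs) → M , rs , refl }) (Rows-unique bs)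
Rows-unique (false ∷ bs) = NumberOf-none λ { _ (() ∷ _) }

NumberOf-Completes : ∀ n (bs : Vec Bool k) → NumberOf (Completes {n = n} bs) (completions n bs)
NumberOf-Completes zero bs = NumberOf-⇔ (λ M rows → rows , λ ()) (λ M → proj₁) (Rows-unique bs)
NumberOf-Completes (suc n) bs = NumberOf-image (uncurry _∷ᶜ_) ∷ᶜ-injective
  (λ { _ (inj₁ p) → Completes-∷ᶜ⁺ p ; _ (inj₂ p) → Completes-∷ᶜ⁺ p })
  split
  (NumberOf-⊎ (λ { _ (_ , st , _) (_ , st′ , _) →
                   case Alternating-functional (Step⇒Alternating st) (Step⇒Alternating st′) of λ () })
    (NumberOf-Step Completes (completions n) (NumberOf-Completes n) false bs)
    (NumberOf-Step Completes (completions n) (NumberOf-Completes n) true bs))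
  where
  split : ∀ M → Completes bs M →
          ∃[ vN ] ((StepCompletes false bs vN ⊎ StepCompletes true bs vN) × M ≡ uncurry _∷ᶜ_ vN)
  split M p with ∷ᶜ-surjective M
  ... | v , N , refl with Completes-∷ᶜ⁻ p
  ...   | false , q = (v , N) , inj₁ q , refl
  ...   | true  , q = (v , N) , inj₂ q , refl

-- Column sums and the conditions on square matrices

trues : Vec Bool k → ℕ
trues []           = 0
trues (true  ∷ bs) = suc (trues bs)
trues (false ∷ bs) = trues bs

Step-trues : {bs bs′ : Vec Bool k} → Step true bs v bs′ → trues bs′ ≡ trues bs
Step-trues-false : {bs bs′ : Vec Bool k} → Step false bs v bs′ → trues bs′ ≡ suc (trues bs)
Step-trues [] = refl
Step-trues (keep {b = true}  st) = cong suc (Step-trues st)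
Step-trues (keep {b = false} st) = Step-trues st
Step-trues (down st) = Step-trues-false st
Step-trues-false (keep {b = true}  st) = cong suc (Step-trues-false st)
Step-trues-false (keep {b = false} st) = Step-trues-false st
Step-trues-false (up st) = cong suc (Step-trues st)

Rows-full : {bs : Vec Bool k} {M : Matrix k 0} → Rows bs M → trues bs ≡ k
Rows-full []        = refl
Rows-full ([] ∷ rs) = cong suc (Rows-full rs)

-- Every column sum is 0 or 1, and all k row sums are 1.

Completes-≤ : ∀ {n} {bs : Vec Bool k} {M : Matrix k n} → Completes bs M → k ≤ trues bs ℕ.+ n
Completes-≤ {n = zero} {bs} (rows , _) =
  ℕ.≤-reflexive (trans (sym (Rows-full rows)) (sym (ℕ.+-identityʳ (trues bs))))
Completes-≤ {n = suc n} {bs} {M} p with ∷ᶜ-surjective M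
... | v , N , refl with Completes-∷ᶜ⁻ p
...   | true  , bs′ , st , q = ℕ.≤-trans (Completes-≤ q)
        (ℕ.+-mono-≤ (ℕ.≤-reflexive (Step-trues st)) (ℕ.n≤1+n n))
...   | false , bs′ , st , q = ℕ.≤-trans (Completes-≤ q)
        (ℕ.≤-reflexive (trans (cong (ℕ._+ n) (Step-trues-false st)) (sym (ℕ.+-suc (trues bs) n))))

-- The `n` columns must supply `n` missing ones and each supplies at most one, so a column of sum 0
-- would leave too few columns. State `false` then yields the two conditions imposed on square
-- matrices.
Completes-square : ∀ {n} {bs : Vec Bool k} {M : Matrix k n} → k ≡ trues bs ℕ.+ n → Completes bs M →
                   ∀ j → Alternating false (column M j)
Completes-square {n = suc n} {bs} {M} k≡ p j with ∷ᶜ-surjective M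
... | v , N , refl with Completes-∷ᶜ⁻ p
...   | true , bs′ , st , q = contradiction
        (subst₂ _≤_ k≡ (cong (ℕ._+ n) (Step-trues st)) (Completes-≤ q))
        (ℕ.<⇒≱ (ℕ.+-monoʳ-< (trues bs) ℕ.≤-refl))
Completes-square {n = suc n} {bs} k≡ p zero | v , N , refl | false , bs′ , st , q =
  subst (Alternating false) (sym (column-zero v N)) (Step⇒Alternating st)
Completes-square {n = suc n} {bs} k≡ p (suc j) | v , N , refl | false , bs′ , st , q =
  subst (Alternating false) (sym (column-suc v N j))
    (Completes-square (trans k≡ (trans (ℕ.+-suc (trues bs) n) (cong (ℕ._+ n) (sym (Step-trues-false st))))) q j)

-- Alternating sign matrices as completions of the empty state

empty : Vec Bool k
empty = replicate _ false

trues-empty : ∀ k → trues (empty {k}) ≡ 0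
trues-empty zero    = refl
trues-empty (suc k) = trues-empty k

Rows-lookup : {M : Matrix k n} → Rows empty M → ∀ i → Alternating false (row M i)
Rows-lookup (r ∷ rs) zero    = r
Rows-lookup (r ∷ rs) (suc i) = Rows-lookup rs i

Rows-tabulate : {M : Matrix k n} → (∀ i → Alternating false (row M i)) → Rows empty M
Rows-tabulate {M = []}    rs = []
Rows-tabulate {M = r ∷ M} rs = rs zero ∷ Rows-tabulate (rs ∘ suc)

IsASM⇒Completes : (M : Matrix k n) → IsASM M → Completes empty M
IsASM⇒Completes M asm =
  Rows-tabulate (λ i → alternating-false (row M i) (entries i) (rows-alternate i) (row-leftmost i)
                         (row-rightmost i) (row-nonzero i))
  , λ j → alternating (column M j)
            (λ i → subst (_∈ -1ℤ ∷ 0ℤ ∷ 1ℤ ∷ []) (sym (Vec.lookup-map i (λ r → lookup r j) M)) (entries i j))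
            (columns-alternate j) (column-bottommost j)
  where open IsASM asm

Completes⇒IsASM : (M : Matrix k n) → Completes empty M → IsASM M
Completes⇒IsASM {k} {n} M p@(rows , columns) = record
  { entries           = Alternating-entries ∘ Rows-lookup rows
  ; rows-alternate    = Alternating-signs ∘ Rows-lookup rows
  ; columns-alternate = Alternating-signs ∘ proj₂ ∘ columns
  ; row-leftmost      = Alternating-first ∘ Rows-lookup rows
  ; column-bottommost = Alternating-last ∘ proj₂ ∘ columns
  ; row-nonzero       = Alternating-nonzero ∘ Rows-lookup rows
  ; row-rightmost     = Alternating-last ∘ Rows-lookup rows
  ; column-nonzero    = λ k≡n → Alternating-nonzero ∘ square k≡n
  ; column-topmost    = λ k≡n → Alternating-first ∘ square k≡n
  }
  where
  square : k ≡ n → ∀ j → Alternating false (column M j)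
  square k≡n = Completes-square (trans k≡n (cong (ℕ._+ n) (sym (trues-empty k)))) p

NumberOf-IsASM : ∀ k n → NumberOf (IsASM {k} {n}) (completions n (empty {k}))
NumberOf-IsASM k n = NumberOf-⇔ Completes⇒IsASM IsASM⇒Completes (NumberOf-Completes n empty)

-- Rational numbers

ℚ-ring : AlmostCommutativeRing 0ℓ 0ℓ
ℚ-ring = fromCommutativeRing ℚ.+-*-commutativeRing (λ x → dec⇒maybe (0ℚ ℚ.≟ x))

fromℚᵘ-+ : ∀ p q → fromℚᵘ (p ℚᵘ.+ q) ≡ fromℚᵘ p + fromℚᵘ q
fromℚᵘ-+ p q = ℚ.toℚᵘ-injective (begin
  toℚᵘ (fromℚᵘ (p ℚᵘ.+ q))               ≈⟨ ℚ.toℚᵘ-fromℚᵘ (p ℚᵘ.+ q) ⟩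
  p ℚᵘ.+ q                               ≈⟨ ℚᵘ.+-cong (ℚ.toℚᵘ-fromℚᵘ p) (ℚ.toℚᵘ-fromℚᵘ q) ⟨
  toℚᵘ (fromℚᵘ p) ℚᵘ.+ toℚᵘ (fromℚᵘ q)   ≈⟨ ℚ.toℚᵘ-homo-+ (fromℚᵘ p) (fromℚᵘ q) ⟨
  toℚᵘ (fromℚᵘ p + fromℚᵘ q)             ∎)
  where open ℚᵘ.≃-Reasoning

fromℚᵘ-* : ∀ p q → fromℚᵘ (p ℚᵘ.* q) ≡ fromℚᵘ p * fromℚᵘ q
fromℚᵘ-* p q = ℚ.toℚᵘ-injective (begin
  toℚᵘ (fromℚᵘ (p ℚᵘ.* q))               ≈⟨ ℚ.toℚᵘ-fromℚᵘ (p ℚᵘ.* q) ⟩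
  p ℚᵘ.* q                               ≈⟨ ℚᵘ.*-cong (ℚ.toℚᵘ-fromℚᵘ p) (ℚ.toℚᵘ-fromℚᵘ q) ⟨
  toℚᵘ (fromℚᵘ p) ℚᵘ.* toℚᵘ (fromℚᵘ q)   ≈⟨ ℚ.toℚᵘ-homo-* (fromℚᵘ p) (fromℚᵘ q) ⟨
  toℚᵘ (fromℚᵘ p * fromℚᵘ q)             ∎)
  where open ℚᵘ.≃-Reasoning

-- `fromℕ n` is by definition `fromℚᵘ` of a fraction with denominator 1, so the equation can be
-- checked between unnormalised fractions, where it is integer arithmetic.
fromℕ-+ : ∀ m n → fromℕ (m ℕ.+ n) ≡ fromℕ m + fromℕ n
fromℕ-+ m n = trans
  (ℚ.fromℚᵘ-cong {ℚᵘ.mkℚᵘ (ℤ.+ (m ℕ.+ n)) 0} {ℚᵘ.mkℚᵘ (ℤ.+ m) 0 ℚᵘ.+ ℚᵘ.mkℚᵘ (ℤ.+ n) 0}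
    (ℚᵘ.*≡* (cong (ℤ._* ℤ.+ 1) (sym (cong₂ ℤ._+_ (ℤ.*-identityʳ (ℤ.+ m)) (ℤ.*-identityʳ (ℤ.+ n)))))))
  (fromℚᵘ-+ (ℚᵘ.mkℚᵘ (ℤ.+ m) 0) (ℚᵘ.mkℚᵘ (ℤ.+ n) 0))

fromℕ-* : ∀ m n → fromℕ (m ℕ.* n) ≡ fromℕ m * fromℕ n
fromℕ-* m n = trans
  (ℚ.fromℚᵘ-cong {ℚᵘ.mkℚᵘ (ℤ.+ (m ℕ.* n)) 0} {ℚᵘ.mkℚᵘ (ℤ.+ m) 0 ℚᵘ.* ℚᵘ.mkℚᵘ (ℤ.+ n) 0}
    (ℚᵘ.*≡* (cong (ℤ._* ℤ.+ 1) (ℤ.pos-* m n))))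
  (fromℚᵘ-* (ℚᵘ.mkℚᵘ (ℤ.+ m) 0) (ℚᵘ.mkℚᵘ (ℤ.+ n) 0))

fromℕ-suc : ∀ n → fromℕ (suc n) ≡ 1ℚ + fromℕ n
fromℕ-suc = fromℕ-+ 1

fromℕ-injective : ∀ {m n} → fromℕ m ≡ fromℕ n → m ≡ n
fromℕ-injective {m} {n} eq
  with ℚᵘ.*≡* eq′ ← ℚ.fromℚᵘ-injective {ℚᵘ.mkℚᵘ (ℤ.+ m) 0} {ℚᵘ.mkℚᵘ (ℤ.+ n) 0} eq =
  ℤ.+-injective (trans (sym (ℤ.*-identityʳ (ℤ.+ m))) (trans eq′ (ℤ.*-identityʳ (ℤ.+ n))))

fromℕ≢0 : ∀ n → .{{NonZero n}} → fromℕ n ≢ 0ℚ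
fromℕ≢0 (suc n) eq with () ← fromℕ-injective {suc n} {0} eq

/-*-cancel : ∀ m n → .{{_ : NonZero n}} → (ℤ.+ m / n) * fromℕ n ≡ fromℕ m
/-*-cancel m (suc n) = trans
  (sym (fromℚᵘ-* (ℚᵘ.mkℚᵘ (ℤ.+ m) n) (ℚᵘ.mkℚᵘ (ℤ.+ suc n) 0)))
  (ℚ.fromℚᵘ-cong {ℚᵘ.mkℚᵘ (ℤ.+ m) n ℚᵘ.* ℚᵘ.mkℚᵘ (ℤ.+ suc n) 0} {ℚᵘ.mkℚᵘ (ℤ.+ m) 0}
    (ℚᵘ.*≡* (trans (ℤ.*-identityʳ (ℤ.+ m ℤ.* ℤ.+ suc n))
                   (cong (λ x → ℤ.+ m ℤ.* ℤ.+ suc x) (sym (ℕ.*-identityʳ n))))))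

-- Extended by inv 0ℚ ≡ 0ℚ.

inv : ℚ → ℚ
inv p with p ℚ.≟ 0ℚ
... | yes _   = 0ℚ
... | no  p≢0 = (1/ p) {{≢-nonZero p≢0}}

inv-cancel : ∀ {p} → p ≢ 0ℚ → p * inv p ≡ 1ℚ
inv-cancel {p} p≢0 with p ℚ.≟ 0ℚ
... | yes p≡0 = contradiction p≡0 p≢0
... | no  p≢0 = ℚ.*-inverseʳ p {{≢-nonZero p≢0}}

*-cancelʳ : ∀ {p q} r → r ≢ 0ℚ → p * r ≡ q * r → p ≡ q
*-cancelʳ {p} {q} r r≢0 eq = begin
  p               ≡⟨ ℚ.*-identityʳ p ⟨
  p * 1ℚ          ≡⟨ cong (p *_) (inv-cancel r≢0) ⟨
  p * (r * inv r) ≡⟨ ℚ.*-assoc p r (inv r) ⟨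
  p * r * inv r   ≡⟨ cong (_* inv r) eq ⟩
  q * r * inv r   ≡⟨ ℚ.*-assoc q r (inv r) ⟩
  q * (r * inv r) ≡⟨ cong (q *_) (inv-cancel r≢0) ⟩
  q * 1ℚ          ≡⟨ ℚ.*-identityʳ q ⟩
  q               ∎
  where open ≡-Reasoning

inv-unique : ∀ {p q} → p * q ≡ 1ℚ → inv p ≡ q
inv-unique {p} {q} pq≡1 = *-cancelʳ p p≢0
  (trans (ℚ.*-comm (inv p) p) (trans (inv-cancel p≢0) (trans (sym pq≡1) (ℚ.*-comm p q))))
  where
  p≢0 : p ≢ 0ℚ
  p≢0 refl with () ← trans (sym (ℚ.*-zeroˡ q)) pq≡1

*≢0 : ∀ {p q} → p ≢ 0ℚ → q ≢ 0ℚ → p * q ≢ 0ℚ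
*≢0 {p} {q} p≢0 q≢0 pq≡0 = p≢0 (*-cancelʳ q q≢0 (trans pq≡0 (sym (ℚ.*-zeroˡ q))))

-≢0 : ∀ {p q} → p ≢ q → p - q ≢ 0ℚ
-≢0 {p} {q} p≢q p-q≡0 = p≢q (begin
  p           ≡⟨ e p q ⟩
  p - q + q   ≡⟨ cong (_+ q) p-q≡0 ⟩
  0ℚ + q      ≡⟨ ℚ.+-identityˡ q ⟩
  q           ∎)
  where
  open ≡-Reasoning
  e : ∀ p q → p ≡ p - q + q
  e = solve-∀ ℚ-ring

inv-neg : ∀ {p q} → p ≢ q → inv (q - p) ≡ - inv (p - q)
inv-neg {p} {q} p≢q = inv-unique {q - p} (trans (e p q (inv (p - q))) (inv-cancel (-≢0 p≢q)))
  where
  e : ∀ p q i → (q - p) * (- i) ≡ (p - q) * i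
  e = solve-∀ ℚ-ring

-- Partial fractions

∏ₗ : {A : Set} → (A → ℚ) → List A → ℚ
∏ₗ f []       = 1ℚ
∏ₗ f (x ∷ xs) = f x * ∏ₗ f xs

-- The residues of ∏ (z − q y) / (z − p y) at its poles p x, weighted by φ x.

module Residues {A : Set} (p q : A → ℚ) where

  ratio : A → A → ℚ
  ratio x y = (p x - q y) * inv (p x - p y)

  -- The factor belonging to a pole already passed is absorbed into the weight `φ`, so that the
  -- product over all other poles needs no list with one element removed.
  residues : (A → ℚ) → List A → ℚ
  residues φ []       = 0ℚ
  residues φ (x ∷ xs) = φ x * (p x - q x) * ∏ₗ (ratio x) xs + residues (λ y → φ y * ratio y x) xs

  Distinct : List A → Set
  Distinct = AllPairs (λ x y → p x ≢ p y)

  -- The relation between the weights is required only on the listed poles, since the relations used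
  -- later hold only away from coinciding poles.
  residues-linear : ∀ a b {χ φ ψ} xs → All (λ x → χ x ≡ a * φ x + b * ψ x) xs →
                    residues χ xs ≡ a * residues φ xs + b * residues ψ xs
  residues-linear a b [] [] = e a b
    where
    e : ∀ a b → 0ℚ ≡ a * 0ℚ + b * 0ℚ
    e = solve-∀ ℚ-ring
  residues-linear a b {χ} {φ} {ψ} (x ∷ xs) (eq ∷ eqs) = begin
    χ x * d * r + residues (λ y → χ y * ratio y x) xs
      ≡⟨ cong₂ (λ u v → u * d * r + v) eq (residues-linear a b xs (All.map (λ {y} → step y) eqs)) ⟩
    (a * φ x + b * ψ x) * d * r
      + (a * residues (λ y → φ y * ratio y x) xs + b * residues (λ y → ψ y * ratio y x) xs)
      ≡⟨ collect a b (φ x) (ψ x) d r _ _ ⟩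
    a * (φ x * d * r + residues (λ y → φ y * ratio y x) xs)
      + b * (ψ x * d * r + residues (λ y → ψ y * ratio y x) xs) ∎
    where
    open ≡-Reasoning
    d = p x - q x
    r = ∏ₗ (ratio x) xs
    distrib : ∀ a b f g s → (a * f + b * g) * s ≡ a * (f * s) + b * (g * s)
    distrib = solve-∀ ℚ-ring
    step : ∀ y → χ y ≡ a * φ y + b * ψ y → χ y * ratio y x ≡ a * (φ y * ratio y x) + b * (ψ y * ratio y x)
    step y e = trans (cong (_* ratio y x) e) (distrib a b (φ y) (ψ y) (ratio y x))
    collect : ∀ a b f g d r s t → (a * f + b * g) * d * r + (a * s + b * t)
                                ≡ a * (f * d * r + s) + b * (g * d * r + t)
    collect = solve-∀ ℚ-ring

  ratio-split : ∀ x y → p x ≢ p y → ratio x y ≡ 1ℚ + (p y - q y) * inv (p x - p y)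
  ratio-split x y x≢y = begin
    (p x - q y) * i                           ≡⟨ e (p x) (p y) (q y) i ⟩
    (p x - p y) * i + (p y - q y) * i         ≡⟨ cong (_+ (p y - q y) * i) (inv-cancel (-≢0 x≢y)) ⟩
    1ℚ + (p y - q y) * i                      ∎
    where
    open ≡-Reasoning
    i = inv (p x - p y)
    e : ∀ px py qy i → (px - qy) * i ≡ (px - py) * i + (py - qy) * i
    e = solve-∀ ℚ-ring

  inv-product : ∀ z x y → p z ≢ p x → p z ≢ p y → p x ≢ p y →
                inv (p z - p x) * inv (p z - p y) ≡ inv (p x - p y) * (inv (p z - p x) - inv (p z - p y))
  inv-product z x y z≢x z≢y x≢y = begin
    i * j                                                  ≡⟨ ℚ.*-identityˡ (i * j) ⟨
    1ℚ * (i * j)                                           ≡⟨ cong (_* (i * j)) (inv-cancel (-≢0 x≢y)) ⟨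
    (p x - p y) * l * (i * j)                              ≡⟨ e (p x) (p y) (p z) i j l ⟩
    l * (i * ((p z - p y) * j) - j * ((p z - p x) * i))
      ≡⟨ cong₂ (λ u v → l * (i * u - j * v)) (inv-cancel (-≢0 z≢y)) (inv-cancel (-≢0 z≢x)) ⟩
    l * (i * 1ℚ - j * 1ℚ)
      ≡⟨ cong₂ (λ u v → l * (u - v)) (ℚ.*-identityʳ i) (ℚ.*-identityʳ j) ⟩
    l * (i - j)                                            ∎
    where
    open ≡-Reasoning
    i = inv (p z - p x)
    j = inv (p z - p y)
    l = inv (p x - p y)
    e : ∀ x y z i j l → (x - y) * l * (i * j) ≡ l * (i * ((z - y) * j) - j * ((z - x) * i))
    e = solve-∀ ℚ-ring

  -- Adding the pole of `x` multiplies by `1 + d * i`. Its product with the term of an older pole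
  -- splits by `inv-product`; everything that lands on the new pole is collected by the induction
  -- hypothesis at the point `x` itself, which turns `1 + Rx` back into a product.
  partial-fractions : ∀ xs → Distinct xs → ∀ z → All (λ x → p z ≢ p x) xs →
                      ∏ₗ (ratio z) xs ≡ 1ℚ + residues (λ x → inv (p z - p x)) xs
  partial-fractions [] [] z [] = refl
  partial-fractions (x ∷ xs) (x≢ ∷ distinct) z (z≢x ∷ z≢) = begin
    ratio z x * ∏ₗ (ratio z) xs
      ≡⟨ cong₂ _*_ (ratio-split z x z≢x) (partial-fractions xs distinct z z≢) ⟩
    (1ℚ + d * i) * (1ℚ + residues (λ y → inv (p z - p y)) xs)
      ≡⟨ expand d i Rz Rx ⟩
    1ℚ + (i * d * (1ℚ + Rx) + ((1ℚ + d * i) * Rz + (- (d * i)) * Rx))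
      ≡⟨ cong₂ (λ u v → 1ℚ + (i * d * u + v)) (sym (partial-fractions xs distinct x x≢))
               (sym (residues-linear (1ℚ + d * i) (- (d * i)) xs
                   (All.zipWith (λ {y} (z≢y , x≢y) → term y z≢y x≢y) (z≢ , x≢)))) ⟩
    1ℚ + (i * d * ∏ₗ (ratio x) xs + residues (λ y → inv (p z - p y) * ratio y x) xs) ∎
    where
    open ≡-Reasoning
    d = p x - q x
    i = inv (p z - p x)
    Rz = residues (λ y → inv (p z - p y)) xs
    Rx = residues (λ y → inv (p x - p y)) xs
    expand : ∀ d i Rz Rx → (1ℚ + d * i) * (1ℚ + Rz)
                         ≡ 1ℚ + (i * d * (1ℚ + Rx) + ((1ℚ + d * i) * Rz + (- (d * i)) * Rx))
    expand = solve-∀ ℚ-ring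
    regroup₁ : ∀ d j l → j * (1ℚ + d * (- l)) ≡ j + d * (- (l * j))
    regroup₁ = solve-∀ ℚ-ring
    regroup₂ : ∀ d i j l → j + d * (- (l * j)) ≡ j + d * (l * (i - j)) + (- (d * i)) * l
    regroup₂ = solve-∀ ℚ-ring
    regroup₃ : ∀ d i j l → j + d * (i * j) + (- (d * i)) * l ≡ (1ℚ + d * i) * j + (- (d * i)) * l
    regroup₃ = solve-∀ ℚ-ring
    term : ∀ y → p z ≢ p y → p x ≢ p y →
           inv (p z - p y) * ratio y x ≡ (1ℚ + d * i) * inv (p z - p y) + (- (d * i)) * inv (p x - p y)
    term y z≢y x≢y = begin
      j * ratio y x                            ≡⟨ cong (j *_) (ratio-split y x (x≢y ∘ sym)) ⟩
      j * (1ℚ + d * inv (p y - p x))           ≡⟨ cong (λ u → j * (1ℚ + d * u)) (inv-neg x≢y) ⟩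
      j * (1ℚ + d * (- l))                     ≡⟨ regroup₁ d j l ⟩
      j + d * (- (l * j))                      ≡⟨ regroup₂ d i j l ⟩
      j + d * (l * (i - j)) + (- (d * i)) * l
        ≡⟨ cong (λ u → j + d * u + (- (d * i)) * l) (inv-product z x y z≢x z≢y x≢y) ⟨
      j + d * (i * j) + (- (d * i)) * l        ≡⟨ regroup₃ d i j l ⟩
      (1ℚ + d * i) * j + (- (d * i)) * l       ∎
      where
      j = inv (p z - p y)
      l = inv (p x - p y)

  Σ-differences : List A → ℚ
  Σ-differences []       = 0ℚ
  Σ-differences (x ∷ xs) = (p x - q x) + Σ-differences xs

  -- Both sides are the coefficient of 1/z in the expansion of ∏ (z − q y) / (z − p y) at infinity.

  Σ-residues : ∀ xs → Distinct xs → residues (λ _ → 1ℚ) xs ≡ Σ-differences xs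
  Σ-residues [] [] = refl
  Σ-residues (x ∷ xs) (x≢ ∷ distinct) = begin
    1ℚ * d * ∏ₗ (ratio x) xs + residues (λ y → 1ℚ * ratio y x) xs
      -- The new pole contributes `d * (1 + R)`; the extra factor `ratio y x` changes the other
      -- residues by `- d * R` in total, so only `d` survives.
      ≡⟨ cong₂ (λ u v → 1ℚ * d * u + v) (partial-fractions xs distinct x x≢)
               (residues-linear 1ℚ (- d) xs (All.map (λ {y} → term y) x≢)) ⟩
    1ℚ * d * (1ℚ + R) + (1ℚ * residues (λ _ → 1ℚ) xs + (- d) * R)
      ≡⟨ collect d R (residues (λ _ → 1ℚ) xs) ⟩
    d + residues (λ _ → 1ℚ) xs
      ≡⟨ cong (λ u → d + u) (Σ-residues xs distinct) ⟩
    d + Σ-differences xs ∎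
    where
    open ≡-Reasoning
    d = p x - q x
    R = residues (λ y → inv (p x - p y)) xs
    collect : ∀ d R S → 1ℚ * d * (1ℚ + R) + (1ℚ * S + (- d) * R) ≡ d + S
    collect = solve-∀ ℚ-ring
    rearrange : ∀ d i → 1ℚ * (1ℚ + d * (- i)) ≡ 1ℚ * 1ℚ + (- d) * i
    rearrange = solve-∀ ℚ-ring
    term : ∀ y → p x ≢ p y → 1ℚ * ratio y x ≡ 1ℚ * 1ℚ + (- d) * inv (p x - p y)
    term y x≢y = trans
      (cong (1ℚ *_) (trans (ratio-split y x (x≢y ∘ sym)) (cong (λ u → 1ℚ + d * u) (inv-neg x≢y))))
      (rearrange d (inv (p x - p y)))

inv-* : ∀ {p q} → p ≢ 0ℚ → q ≢ 0ℚ → inv (p * q) ≡ inv p * inv q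
inv-* {p} {q} p≢0 q≢0 = inv-unique {p * q} (trans (swap p q (inv p) (inv q))
  (cong₂ _*_ (inv-cancel p≢0) (inv-cancel q≢0)))
  where
  swap : ∀ p q i j → p * q * (i * j) ≡ p * i * (q * j)
  swap = solve-∀ ℚ-ring

∏ₗ-* : {A : Set} (f g : A → ℚ) (xs : List A) → ∏ₗ (λ x → f x * g x) xs ≡ ∏ₗ f xs * ∏ₗ g xs
∏ₗ-* f g []       = refl
∏ₗ-* f g (x ∷ xs) = trans (cong (f x * g x *_) (∏ₗ-* f g xs)) (swap (f x) (g x) _ _)
  where
  swap : ∀ a b c d → a * b * (c * d) ≡ a * c * (b * d)
  swap = solve-∀ ℚ-ring

∏ₗ-cong : {A : Set} {f g : A → ℚ} {xs : List A} → All (λ x → f x ≡ g x) xs → ∏ₗ f xs ≡ ∏ₗ g xs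
∏ₗ-cong []         = refl
∏ₗ-cong (eq ∷ eqs) = cong₂ _*_ eq (∏ₗ-cong eqs)

-- The hook formula for shifted diagrams

pair : ℕ → ℕ → ℚ
pair x y = (fromℕ y - fromℕ x) * inv (fromℕ y + fromℕ x)

-- For increasing positive parts with sum n, n! times this product is the number of standard
-- tableaux of the shifted shape with these parts: Schur's product over the parts, which is
-- equivalent to the one over hook lengths.
hook : List ℕ → ℚ
hook []       = 1ℚ
hook (x ∷ xs) = inv (fromℕ (x !)) * ∏ₗ (pair x) xs * hook xs

-- With these p and q, the quotient of hook after and before the decrement of
-- the part x is x times a product of ratios ratio x y, because
-- p x − q y = (x − 1 − y) (x + y) and p x − p y = (x − y) (x + y − 1).

P Q : ℕ → ℚ
P x = fromℕ x * (fromℕ x - 1ℚ)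
Q x = fromℕ x * (fromℕ x + 1ℚ)

open Residues P Q

fromℕ-pred : ∀ x → .{{NonZero x}} → fromℕ (pred x) ≡ fromℕ x - 1ℚ
fromℕ-pred (suc x) = trans (e (fromℕ x)) (cong (_- 1ℚ) (sym (fromℕ-suc x)))
  where
  e : ∀ a → a ≡ 1ℚ + a - 1ℚ
  e = solve-∀ ℚ-ring

module _ {x y : ℕ} (x≢0 : NonZero x) (x<y : x < y) where
  private
    instance
      _ = x≢0
      y≢0 : NonZero y
      y≢0 = ℕ.>-nonZero (ℕ.≤-<-trans ℕ.z≤n x<y)
      y+x≢0 : NonZero (y ℕ.+ x)
      y+x≢0 = ℕ.≢-nonZero (ℕ.≢-nonZero⁻¹ y ∘ ℕ.m+n≡0⇒m≡0 y)
      py+x≢0 : NonZero (pred y ℕ.+ x)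
      py+x≢0 = ℕ.≢-nonZero (ℕ.≢-nonZero⁻¹ x ∘ ℕ.m+n≡0⇒n≡0 (pred y))

    X = fromℕ x
    Y = fromℕ y
    δ = Y - X
    σ = Y + X
    τ = Y - 1ℚ + X

    δ≢0 : δ ≢ 0ℚ
    δ≢0 = -≢0 (λ eq → ℕ.<⇒≢ x<y (sym (fromℕ-injective eq)))

    σ≢0 : σ ≢ 0ℚ
    σ≢0 = subst (_≢ 0ℚ) (fromℕ-+ y x) (fromℕ≢0 (y ℕ.+ x))

    τ≢0 : τ ≢ 0ℚ
    τ≢0 = subst (_≢ 0ℚ) (trans (fromℕ-+ (pred y) x) (cong (_+ X) (fromℕ-pred y))) (fromℕ≢0 (pred y ℕ.+ x))

    Py-Px : P y - P x ≡ δ * τ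
    Py-Px = e X Y
      where
      e : ∀ X Y → Y * (Y - 1ℚ) - X * (X - 1ℚ) ≡ (Y - X) * (Y - 1ℚ + X)
      e = solve-∀ ℚ-ring

    -- Decrementing either part leaves the same denominator `τ`, with `a` as the new numerator.
    -- Inserting `δ` and `σ` brings out `pair x y` and leaves `δ * τ`, the difference of poles, as
    -- the other denominator.
    cancel : ∀ a → a * inv τ ≡ δ * inv σ * (a * σ * (inv δ * inv τ))
    cancel a = begin
      a * inv τ                                     ≡⟨ units a (inv τ) ⟩
      1ℚ * 1ℚ * (a * inv τ)
        ≡⟨ cong₂ (λ u v → u * v * (a * inv τ)) (inv-cancel δ≢0) (inv-cancel σ≢0) ⟨
      δ * inv δ * (σ * inv σ) * (a * inv τ)         ≡⟨ swap a δ σ (inv δ) (inv σ) (inv τ) ⟩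
      δ * inv σ * (a * σ * (inv δ * inv τ))         ∎
      where
      open ≡-Reasoning
      units : ∀ a i → a * i ≡ 1ℚ * 1ℚ * (a * i)
      units = solve-∀ ℚ-ring
      swap : ∀ a δ σ i j k → δ * i * (σ * j) * (a * k) ≡ δ * j * (a * σ * (i * k))
      swap = solve-∀ ℚ-ring

  P-distinct : P x ≢ P y
  P-distinct eq = *≢0 δ≢0 τ≢0 (trans (sym Py-Px) (trans (cong (_- P x) (sym eq)) (ℚ.+-inverseʳ (P x))))

  pair-predʳ : pair x (pred y) ≡ pair x y * ratio y x
  pair-predʳ = begin
    (fromℕ (pred y) - X) * inv (fromℕ (pred y) + X)       ≡⟨ cong (λ u → (u - X) * inv (u + X)) (fromℕ-pred y) ⟩
    (Y - 1ℚ - X) * inv τ                                  ≡⟨ cancel (Y - 1ℚ - X) ⟩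
    δ * inv σ * ((Y - 1ℚ - X) * σ * (inv δ * inv τ))
      ≡⟨ cong₂ (λ u v → δ * inv σ * (u * v)) (e X Y) (inv-* δ≢0 τ≢0) ⟨
    δ * inv σ * ((P y - Q x) * inv (δ * τ))               ≡⟨ cong (λ u → δ * inv σ * ((P y - Q x) * inv u)) Py-Px ⟨
    pair x y * ratio y x                                  ∎
    where
    open ≡-Reasoning
    e : ∀ X Y → Y * (Y - 1ℚ) - X * (X + 1ℚ) ≡ (Y - 1ℚ - X) * (Y + X)
    e = solve-∀ ℚ-ring

  pair-predˡ : pair (pred x) y ≡ pair x y * ratio x y
  pair-predˡ = begin
    (Y - fromℕ (pred x)) * inv (Y + fromℕ (pred x))        ≡⟨ cong (λ u → (Y - u) * inv (Y + u)) (fromℕ-pred x) ⟩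
    (Y - (X - 1ℚ)) * inv (Y + (X - 1ℚ))                    ≡⟨ cong (λ u → (Y - (X - 1ℚ)) * inv u) (e₁ X Y) ⟩
    (Y - (X - 1ℚ)) * inv τ                                 ≡⟨ cancel (Y - (X - 1ℚ)) ⟩
    δ * inv σ * ((Y - (X - 1ℚ)) * σ * (inv δ * inv τ))
      ≡⟨ cong (λ u → δ * inv σ * ((Y - (X - 1ℚ)) * σ * u)) (inv-* δ≢0 τ≢0) ⟨
    δ * inv σ * ((Y - (X - 1ℚ)) * σ * inv (δ * τ))
      ≡⟨ cong (λ u → δ * inv σ * ((Y - (X - 1ℚ)) * σ * inv u)) Py-Px ⟨
    δ * inv σ * ((Y - (X - 1ℚ)) * σ * inv (P y - P x))     ≡⟨ cong (δ * inv σ *_) (e₂ X Y (inv (P y - P x))) ⟩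
    δ * inv σ * ((P x - Q y) * - inv (P y - P x))
      ≡⟨ cong (λ u → δ * inv σ * ((P x - Q y) * u)) (inv-neg {P y} {P x} (P-distinct ∘ sym)) ⟨
    pair x y * ratio x y                                   ∎
    where
    open ≡-Reasoning
    e₁ : ∀ X Y → Y + (X - 1ℚ) ≡ Y - 1ℚ + X
    e₁ = solve-∀ ℚ-ring
    e₂ : ∀ X Y i → (Y - (X - 1ℚ)) * (Y + X) * i ≡ (X * (X - 1ℚ) - Y * (Y + 1ℚ)) * - i
    e₂ = solve-∀ ℚ-ring

inv-!-pred : ∀ x → .{{NonZero x}} → inv (fromℕ (pred x !)) ≡ fromℕ x * inv (fromℕ (x !))
inv-!-pred (suc x) = begin
  inv f                       ≡⟨ ℚ.*-identityˡ (inv f) ⟨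
  1ℚ * inv f                  ≡⟨ cong (_* inv f) (inv-cancel (fromℕ≢0 (suc x))) ⟨
  y * inv y * inv f           ≡⟨ ℚ.*-assoc y (inv y) (inv f) ⟩
  y * (inv y * inv f)         ≡⟨ cong (y *_) (inv-* (fromℕ≢0 (suc x)) (fromℕ≢0 (x !) {{x ℕ.!≢0}})) ⟨
  y * inv (y * f)             ≡⟨ cong (λ u → y * inv u) (fromℕ-* (suc x) (x !)) ⟨
  y * inv (fromℕ (suc x !))   ∎
  where
  open ≡-Reasoning
  y = fromℕ (suc x)
  f = fromℕ (x !)

-- The recursion of the hook product under decrements

Σpred : (List ℕ → ℚ) → List ℕ → ℚ
Σpred G []       = 0ℚ
Σpred G (x ∷ xs) = G (pred x ∷ xs) + Σpred (G ∘ (x ∷_)) xs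

Σpred-cong : ∀ {G H} → G ≗ H → Σpred G ≗ Σpred H
Σpred-cong eq []       = refl
Σpred-cong eq (x ∷ xs) = cong₂ _+_ (eq (pred x ∷ xs)) (Σpred-cong (eq ∘ (x ∷_)) xs)

Σpred-*ˡ : ∀ c G xs → Σpred (λ ys → c * G ys) xs ≡ c * Σpred G xs
Σpred-*ˡ c G []       = sym (ℚ.*-zeroʳ c)
Σpred-*ˡ c G (x ∷ xs) = trans (cong (c * G (pred x ∷ xs) +_) (Σpred-*ˡ c (G ∘ (x ∷_)) xs))
                              (sym (ℚ.*-distribˡ-+ c (G (pred x ∷ xs)) _))

-- The difference `P x - Q x` is -2x, whereas decrementing x in the factorial produces a factor x;
-- hence residues and decrements differ by this constant.
-2ℚ : ℚ
-2ℚ = - (1ℚ + 1ℚ)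

-- `M` gathers the factors `pair x y` with the parts `x` already passed, and `m` is the factor by
-- which `M` changes under a decrement. By `pair-predʳ` passing `x` multiplies `m` by `ratio y x`,
-- exactly as `residues` updates its weight. The intended use is `M = m = 1`.
Σpred-hook-residues : ∀ (M m : ℕ → ℚ) {xs} → AllPairs _<_ xs → All NonZero xs →
  All (λ x → M (pred x) ≡ M x * m x) xs →
  -2ℚ * Σpred (λ ys → ∏ₗ M ys * hook ys) xs ≡ ∏ₗ M xs * hook xs * residues m xs
Σpred-hook-residues M m {[]} [] [] [] = refl
Σpred-hook-residues M m {x ∷ xs} (x< ∷ increasing) (x≢0 ∷ ≢0) (Mx ∷ Ms) = begin
  -2ℚ * (M (pred x) * PM * (inv (fromℕ (pred x !)) * ∏ₗ (pair (pred x)) xs * H)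
    + Σpred (λ ys → ∏ₗ M (x ∷ ys) * hook (x ∷ ys)) xs)
    ≡⟨ cong (-2ℚ *_) (cong₂ _+_ head≡ tail≡) ⟩
  -2ℚ * (M x * m x * PM * (fromℕ x * w * (PP * R) * H) + M x * w * S)
    ≡⟨ expand (M x) (m x) PM (fromℕ x) w PP R H S ⟩
  M x * m x * PM * (w * PP * H) * (P x - Q x) * R + M x * w * (-2ℚ * S)
    ≡⟨ cong (λ u → M x * m x * PM * (w * PP * H) * (P x - Q x) * R + M x * w * u) IH ⟩
  M x * m x * PM * (w * PP * H) * (P x - Q x) * R + M x * w * (PM * PP * H * residues m′ xs)
    ≡⟨ collect (M x) (m x) PM w PP R H (P x - Q x) (residues m′ xs) ⟩
  M x * PM * (w * PP * H) * (m x * (P x - Q x) * R + residues m′ xs) ∎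
  where
  open ≡-Reasoning
  M′ = λ y → M y * pair x y
  m′ = λ y → m y * ratio y x
  PM = ∏ₗ M xs
  PP = ∏ₗ (pair x) xs
  H = hook xs
  R = ∏ₗ (ratio x) xs
  w = inv (fromℕ (x !))
  S = Σpred (λ ys → ∏ₗ M′ ys * hook ys) xs
  expand : ∀ Mx mx PM X w PP R H S →
    -2ℚ * (Mx * mx * PM * (X * w * (PP * R) * H) + Mx * w * S)
    ≡ Mx * mx * PM * (w * PP * H) * (X * (X - 1ℚ) - X * (X + 1ℚ)) * R + Mx * w * (-2ℚ * S)
  expand = solve-∀ ℚ-ring
  collect : ∀ Mx mx PM w PP R H D T →
    Mx * mx * PM * (w * PP * H) * D * R + Mx * w * (PM * PP * H * T)
    ≡ Mx * PM * (w * PP * H) * (mx * D * R + T)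
  collect = solve-∀ ℚ-ring
  regroup : ∀ Mx PM w PP H → Mx * PM * (w * PP * H) ≡ Mx * w * (PM * PP * H)
  regroup = solve-∀ ℚ-ring
  swap : ∀ a b c d → a * b * (c * d) ≡ a * c * (b * d)
  swap = solve-∀ ℚ-ring
  head≡ : M (pred x) * PM * (inv (fromℕ (pred x !)) * ∏ₗ (pair (pred x)) xs * H)
        ≡ M x * m x * PM * (fromℕ x * w * (PP * R) * H)
  head≡ = cong₂ _*_ (cong (_* PM) Mx) (cong (_* H) (cong₂ _*_ (inv-!-pred x {{x≢0}})
    (trans (∏ₗ-cong (All.map (λ x<y → pair-predˡ x≢0 x<y) x<)) (∏ₗ-* (pair x) (ratio x) xs))))
  tail≡ : Σpred (λ ys → ∏ₗ M (x ∷ ys) * hook (x ∷ ys)) xs ≡ M x * w * S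
  tail≡ = trans
    (Σpred-cong (λ ys → trans (regroup (M x) (∏ₗ M ys) w (∏ₗ (pair x) ys) (hook ys))
      (cong (λ u → M x * w * (u * hook ys)) (sym (∏ₗ-* M (pair x) ys)))) xs)
    (Σpred-*ˡ (M x * w) (λ ys → ∏ₗ M′ ys * hook ys) xs)
  IH : -2ℚ * S ≡ PM * PP * H * residues m′ xs
  IH = trans
    (Σpred-hook-residues M′ m′ increasing ≢0 (All.zipWith
      (λ { {y} (My , x<y) → trans (cong₂ _*_ My (pair-predʳ x≢0 x<y)) (swap (M y) (m y) (pair x y) (ratio y x)) })
      (Ms , x<)))
    (cong (λ u → u * H * residues m′ xs) (∏ₗ-* M (pair x) xs))

Σ-differences≡ : ∀ xs → Σ-differences xs ≡ -2ℚ * fromℕ (sum xs)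
Σ-differences≡ []       = refl
Σ-differences≡ (x ∷ xs) = begin
  P x - Q x + Σ-differences xs             ≡⟨ cong (P x - Q x +_) (Σ-differences≡ xs) ⟩
  P x - Q x + -2ℚ * fromℕ (sum xs)         ≡⟨ e (fromℕ x) (fromℕ (sum xs)) ⟩
  -2ℚ * (fromℕ x + fromℕ (sum xs))         ≡⟨ cong (-2ℚ *_) (fromℕ-+ x (sum xs)) ⟨
  -2ℚ * fromℕ (x ℕ.+ sum xs)               ∎
  where
  open ≡-Reasoning
  e : ∀ X S → X * (X - 1ℚ) - X * (X + 1ℚ) + -2ℚ * S ≡ -2ℚ * (X + S)
  e = solve-∀ ℚ-ring

increasing⇒distinct : ∀ {xs} → AllPairs _<_ xs → All NonZero xs → Distinct xs
increasing⇒distinct []          []         = []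
increasing⇒distinct (x< ∷ incr) (x≢0 ∷ ≢0) = All.map (P-distinct x≢0) x< ∷ increasing⇒distinct incr ≢0

∏ₗ-1 : {A : Set} (xs : List A) → ∏ₗ (λ _ → 1ℚ) xs ≡ 1ℚ
∏ₗ-1 []       = refl
∏ₗ-1 (x ∷ xs) = trans (ℚ.*-identityˡ _) (∏ₗ-1 xs)

Σpred-hook : ∀ {xs} → AllPairs _<_ xs → All NonZero xs → Σpred hook xs ≡ fromℕ (sum xs) * hook xs
Σpred-hook {xs} increasing ≢0 = *-cancelʳ -2ℚ (λ ()) (begin
  Σpred hook xs * -2ℚ                                    ≡⟨ ℚ.*-comm (Σpred hook xs) -2ℚ ⟩
  -2ℚ * Σpred hook xs                                    ≡⟨ cong (-2ℚ *_) (Σpred-cong unit xs) ⟩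
  -2ℚ * Σpred (λ ys → ∏ₗ (λ _ → 1ℚ) ys * hook ys) xs
    ≡⟨ Σpred-hook-residues (λ _ → 1ℚ) (λ _ → 1ℚ) increasing ≢0 (All.universal (λ _ → refl) xs) ⟩
  ∏ₗ (λ _ → 1ℚ) xs * hook xs * residues (λ _ → 1ℚ) xs
    ≡⟨ cong₂ _*_ (sym (unit xs)) (trans (Σ-residues xs (increasing⇒distinct increasing ≢0)) (Σ-differences≡ xs)) ⟩
  hook xs * (-2ℚ * fromℕ (sum xs))                       ≡⟨ swap (hook xs) (fromℕ (sum xs)) ⟩
  fromℕ (sum xs) * hook xs * -2ℚ                         ∎)
  where
  open ≡-Reasoning
  unit : ∀ ys → hook ys ≡ ∏ₗ (λ _ → 1ℚ) ys * hook ys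
  unit ys = sym (trans (cong (_* hook ys) (∏ₗ-1 ys)) (ℚ.*-identityˡ (hook ys)))
  swap : ∀ h s → h * (-2ℚ * s) ≡ s * h * -2ℚ
  swap = solve-∀ ℚ-ring

-- The factor `pair x x` has numerator 0. Two neighbours suffice, because in an increasing list a
-- decremented part can only collide with its predecessor.
hook-repeated : ∀ us x ys → hook (us ++ x ∷ x ∷ ys) ≡ 0ℚ
hook-repeated [] x ys = trans
  (cong (λ u → w * (u * inv (fromℕ x + fromℕ x) * R) * H) (ℚ.+-inverseʳ (fromℕ x)))
  (e w (inv (fromℕ x + fromℕ x)) R H)
  where
  w = inv (fromℕ (x !))
  R = ∏ₗ (pair x) ys
  H = hook (x ∷ ys)
  e : ∀ w i R H → w * (0ℚ * i * R) * H ≡ 0ℚ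
  e = solve-∀ ℚ-ring
hook-repeated (u ∷ us) x ys = trans (cong (w *_) (hook-repeated us x ys)) (ℚ.*-zeroʳ w)
  where
  w = inv (fromℕ (u !)) * ∏ₗ (pair u) (us ++ x ∷ x ∷ ys)

-- Since 0! = 1 and `pair 0 y` is 1 for non-zero `y`, a part that has been decremented to 0 may stay
-- in the list.
hook-0∷ : ∀ {xs} → All NonZero xs → hook (0 ∷ xs) ≡ hook xs
hook-0∷ {xs} ≢0 = trans
  (cong (λ u → inv 1ℚ * u * hook xs) (trans (∏ₗ-cong (All.map (λ {y} → pair-0 y) ≢0)) (∏ₗ-1 xs)))
  (ℚ.*-identityˡ (hook xs))
  where
  e₁ : ∀ a → a - 0ℚ ≡ a
  e₁ = solve-∀ ℚ-ring
  pair-0 : ∀ y → NonZero y → pair 0 y ≡ 1ℚ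
  pair-0 y y≢0 = trans (cong₂ (λ u v → u * inv v) (e₁ (fromℕ y)) (ℚ.+-identityʳ (fromℕ y)))
      (inv-cancel (fromℕ≢0 y {{y≢0}}))

-- Steps other than the zero column

ΣStep≢0 : Vec Bool k → (Vec Bool k → ℕ) → ℕ
ΣStep≢0 []           F = 0
ΣStep≢0 (true  ∷ bs) F = ΣStep≢0 bs (F ∘ (true ∷_)) ℕ.+ ΣStep false bs (F ∘ (false ∷_))
ΣStep≢0 (false ∷ bs) F = ΣStep≢0 bs (F ∘ (false ∷_))

ΣStep-true : ∀ (bs : Vec Bool k) F → ΣStep true bs F ≡ F bs ℕ.+ ΣStep≢0 bs F
ΣStep-true []           F = sym (ℕ.+-identityʳ (F []))
ΣStep-true (true  ∷ bs) F = trans (cong (ℕ._+ ΣStep false bs (F ∘ (false ∷_))) (ΣStep-true bs (F ∘ (true ∷_))))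
                                  (ℕ.+-assoc (F (true ∷ bs)) _ _)
ΣStep-true (false ∷ bs) F = ΣStep-true bs (F ∘ (false ∷_))

-- A column starting in state `false` contains a 1 in any case, so the zero column has to be left
-- out only for state `true`.
advance : Vec Bool k → (Vec Bool k → ℕ) → ℕ
advance bs F = ΣStep false bs F ℕ.+ ΣStep≢0 bs F

chains : ℕ → Vec Bool k → ℕ
chains zero    bs = isFull bs
chains (suc m) bs = advance bs (chains m)

-- The zero column contributes `completions n bs` itself, so `advance` is the forward difference in
-- `n`; this is the source of the binomial coefficients.
completions-suc : ∀ n (bs : Vec Bool k) → completions (suc n) bs ≡ completions n bs ℕ.+ advance bs (completions n)
completions-suc n bs = trans (cong (ΣStep false bs (completions n) ℕ.+_) (ΣStep-true bs (completions n)))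
  (e (ΣStep false bs (completions n)) (completions n bs) (ΣStep≢0 bs (completions n)))
  where
  e : ∀ a b c → a ℕ.+ (b ℕ.+ c) ≡ b ℕ.+ (a ℕ.+ c)
  e = ℕ-solve-∀

ΣStep-cong : ∀ c (bs : Vec Bool k) {F G} → F ≗ G → ΣStep c bs F ≡ ΣStep c bs G
ΣStep-cong true  []           eq = eq []
ΣStep-cong false []           eq = refl
ΣStep-cong true  (true  ∷ bs) eq = cong₂ ℕ._+_ (ΣStep-cong true bs (eq ∘ (true ∷_)))
    (ΣStep-cong false bs (eq ∘ (false ∷_)))
ΣStep-cong true  (false ∷ bs) eq = ΣStep-cong true bs (eq ∘ (false ∷_))
ΣStep-cong false (true  ∷ bs) eq = ΣStep-cong false bs (eq ∘ (true ∷_))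
ΣStep-cong false (false ∷ bs) eq = cong₂ ℕ._+_ (ΣStep-cong false bs (eq ∘ (false ∷_)))
    (ΣStep-cong true bs (eq ∘ (true ∷_)))

ΣStep≢0-cong : ∀ (bs : Vec Bool k) {F G} → F ≗ G → ΣStep≢0 bs F ≡ ΣStep≢0 bs G
ΣStep≢0-cong []           eq = refl
ΣStep≢0-cong (true  ∷ bs) eq = cong₂ ℕ._+_ (ΣStep≢0-cong bs (eq ∘ (true ∷_)))
    (ΣStep-cong false bs (eq ∘ (false ∷_)))
ΣStep≢0-cong (false ∷ bs) eq = ΣStep≢0-cong bs (eq ∘ (false ∷_))

advance-cong : ∀ (bs : Vec Bool k) {F G} → F ≗ G → advance bs F ≡ advance bs G
advance-cong bs eq = cong₂ ℕ._+_ (ΣStep-cong false bs eq) (ΣStep≢0-cong bs eq)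

+-linear : ∀ w {x y a b c d} → x ≡ a ℕ.+ w ℕ.* b → y ≡ c ℕ.+ w ℕ.* d → x ℕ.+ y ≡ (a ℕ.+ c) ℕ.+ w ℕ.* (b ℕ.+ d)
+-linear w {a = a} {b} {c} {d} refl refl = e w a b c d
  where
  e : ∀ w a b c d → (a ℕ.+ w ℕ.* b) ℕ.+ (c ℕ.+ w ℕ.* d) ≡ (a ℕ.+ c) ℕ.+ w ℕ.* (b ℕ.+ d)
  e = ℕ-solve-∀

ΣStep-linear : ∀ c (bs : Vec Bool k) F w G →
               ΣStep c bs (λ b → F b ℕ.+ w ℕ.* G b) ≡ ΣStep c bs F ℕ.+ w ℕ.* ΣStep c bs G
ΣStep-linear true  []           F w G = refl
ΣStep-linear false []           F w G = sym (ℕ.*-zeroʳ w)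
ΣStep-linear true  (true  ∷ bs) F w G = +-linear w
  (ΣStep-linear true bs (F ∘ (true ∷_)) w (G ∘ (true ∷_)))
  (ΣStep-linear false bs (F ∘ (false ∷_)) w (G ∘ (false ∷_)))
ΣStep-linear true  (false ∷ bs) F w G = ΣStep-linear true bs (F ∘ (false ∷_)) w (G ∘ (false ∷_))
ΣStep-linear false (true  ∷ bs) F w G = ΣStep-linear false bs (F ∘ (true ∷_)) w (G ∘ (true ∷_))
ΣStep-linear false (false ∷ bs) F w G = +-linear w
  (ΣStep-linear false bs (F ∘ (false ∷_)) w (G ∘ (false ∷_)))
  (ΣStep-linear true bs (F ∘ (true ∷_)) w (G ∘ (true ∷_)))

ΣStep≢0-linear : ∀ (bs : Vec Bool k) F w G →
                 ΣStep≢0 bs (λ b → F b ℕ.+ w ℕ.* G b) ≡ ΣStep≢0 bs F ℕ.+ w ℕ.* ΣStep≢0 bs G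
ΣStep≢0-linear []           F w G = sym (ℕ.*-zeroʳ w)
ΣStep≢0-linear (true  ∷ bs) F w G = +-linear w
  (ΣStep≢0-linear bs (F ∘ (true ∷_)) w (G ∘ (true ∷_))) (ΣStep-linear false bs (F ∘ (false ∷_)) w (G ∘ (false ∷_)))
ΣStep≢0-linear (false ∷ bs) F w G = ΣStep≢0-linear bs (F ∘ (false ∷_)) w (G ∘ (false ∷_))

advance-linear : ∀ (bs : Vec Bool k) F w G →
                 advance bs (λ b → F b ℕ.+ w ℕ.* G b) ≡ advance bs F ℕ.+ w ℕ.* advance bs G
advance-linear bs F w G = +-linear w (ΣStep-linear false bs F w G) (ΣStep≢0-linear bs F w G)

-- Weights

zeros : ℕ → Vec Bool k → List ℕ
zeros a []           = []
zeros a (true  ∷ bs) = zeros (suc a) bs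
zeros a (false ∷ bs) = a ∷ zeros (suc a) bs

weight : ℕ → Vec Bool k → ℕ
weight a bs = sum (zeros a bs)

-- With positions numbered from `a`, a column of sum 1 lowers the weight by at least `a`, and one of
-- sum 0 never raises it. Stated as the vanishing of a sum, this bound needs no separate description
-- of the reachable states.
ΣStep-false-≡0 : ∀ a (bs : Vec Bool k) F → (∀ bs′ → weight a bs′ ℕ.+ a ≤ weight a bs → F bs′ ≡ 0) →
    ΣStep false bs F ≡ 0
ΣStep-true-≡0 : ∀ a (bs : Vec Bool k) F → (∀ bs′ → weight a bs′ ≤ weight a bs → F bs′ ≡ 0) → ΣStep true bs F ≡ 0
ΣStep-false-≡0 a [] F F≡0 = refl
ΣStep-false-≡0 a (true ∷ bs) F F≡0 = ΣStep-false-≡0 (suc a) bs (F ∘ (true ∷_))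
  λ bs′ le → F≡0 (true ∷ bs′) (ℕ.≤-trans (ℕ.+-monoʳ-≤ (weight (suc a) bs′) (ℕ.n≤1+n a)) le)
ΣStep-false-≡0 a (false ∷ bs) F F≡0 = cong₂ ℕ._+_
  (ΣStep-false-≡0 (suc a) bs (F ∘ (false ∷_)) λ bs′ le → F≡0 (false ∷ bs′)
    (ℕ.≤-trans (ℕ.≤-reflexive (ℕ.+-assoc a _ a))
      (ℕ.+-monoʳ-≤ a (ℕ.≤-trans (ℕ.+-monoʳ-≤ (weight (suc a) bs′) (ℕ.n≤1+n a)) le))))
  (ΣStep-true-≡0 (suc a) bs (F ∘ (true ∷_)) λ bs′ le → F≡0 (true ∷ bs′)
    (ℕ.≤-trans (ℕ.≤-reflexive (ℕ.+-comm (weight (suc a) bs′) a)) (ℕ.+-monoʳ-≤ a le)))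
ΣStep-true-≡0 a [] F F≡0 = F≡0 [] z≤n
ΣStep-true-≡0 a (true ∷ bs) F F≡0 = cong₂ ℕ._+_
  (ΣStep-true-≡0 (suc a) bs (F ∘ (true ∷_)) (F≡0 ∘ (true ∷_)))
  (ΣStep-false-≡0 (suc a) bs (F ∘ (false ∷_)) λ bs′ le → F≡0 (false ∷ bs′)
    (ℕ.≤-trans (ℕ.≤-reflexive (ℕ.+-comm a (weight (suc a) bs′)))
      (ℕ.≤-trans (ℕ.+-monoʳ-≤ (weight (suc a) bs′) (ℕ.n≤1+n a)) le)))
ΣStep-true-≡0 a (false ∷ bs) F F≡0 =
  ΣStep-true-≡0 (suc a) bs (F ∘ (false ∷_)) λ bs′ le → F≡0 (false ∷ bs′) (ℕ.+-monoʳ-≤ a le)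

-- A first entry -1 at position `a` adds `a`, while the rest is a column of sum 1 beyond `a` and
-- removes at least `suc a`.
ΣStep≢0-≡0 : ∀ a (bs : Vec Bool k) F → (∀ bs′ → weight a bs′ < weight a bs → F bs′ ≡ 0) → ΣStep≢0 bs F ≡ 0
ΣStep≢0-≡0 a [] F F≡0 = refl
ΣStep≢0-≡0 a (true ∷ bs) F F≡0 = cong₂ ℕ._+_
  (ΣStep≢0-≡0 (suc a) bs (F ∘ (true ∷_)) (F≡0 ∘ (true ∷_)))
  (ΣStep-false-≡0 (suc a) bs (F ∘ (false ∷_)) λ bs′ le → F≡0 (false ∷ bs′)
    (ℕ.≤-trans (ℕ.≤-reflexive (ℕ.+-comm (suc a) (weight (suc a) bs′))) le))
ΣStep≢0-≡0 a (false ∷ bs) F F≡0 =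
  ΣStep≢0-≡0 (suc a) bs (F ∘ (false ∷_)) λ bs′ le → F≡0 (false ∷ bs′) (ℕ.+-monoʳ-< a le)

-- Every step now costs at least 1. Positions are numbered from 1 so that a column of sum 1 with its
-- only non-zero entry in the top row costs something too.
chains-≡0 : ∀ m (bs : Vec Bool k) → weight 1 bs < m → chains m bs ≡ 0
chains-≡0 (suc m) bs (s≤s w≤m) = cong₂ ℕ._+_
  (ΣStep-false-≡0 1 bs (chains m) λ bs′ le →
    chains-≡0 m bs′ (ℕ.≤-trans (ℕ.≤-reflexive (ℕ.+-comm 1 _)) (ℕ.≤-trans le w≤m)))
  (ΣStep≢0-≡0 1 bs (chains m) λ bs′ le → chains-≡0 m bs′ (ℕ.≤-trans le w≤m))

-- Steps that lower the weight by exactly one: either the zero at the first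
-- position disappears, or some zero moves to the preceding position.

dropFirst : Vec Bool k → (Vec Bool k → ℚ) → ℚ
dropFirst []           G = 0ℚ
dropFirst (true  ∷ bs) G = 0ℚ
dropFirst (false ∷ bs) G = G (true ∷ bs)

moveDown : Vec Bool k → (Vec Bool k → ℚ) → ℚ
moveDown []           G = 0ℚ
moveDown (true  ∷ bs) G = moveDown bs (G ∘ (true ∷_)) + dropFirst bs (G ∘ (false ∷_))
moveDown (false ∷ bs) G = moveDown bs (G ∘ (false ∷_))

dropFirst-cong : ∀ (bs : Vec Bool k) {F G} → F ≗ G → dropFirst bs F ≡ dropFirst bs G
dropFirst-cong []           eq = refl
dropFirst-cong (true  ∷ bs) eq = refl
dropFirst-cong (false ∷ bs) eq = eq (true ∷ bs)

dropFirst-0 : ∀ (bs : Vec Bool k) → dropFirst bs (λ _ → 0ℚ) ≡ 0ℚ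
dropFirst-0 []           = refl
dropFirst-0 (true  ∷ bs) = refl
dropFirst-0 (false ∷ bs) = refl

-- A drop of exactly `a` forces a 1 at the first position and zeros elsewhere; a 1 further down, or
-- any further non-zero entry, lowers the weight by more, where `F` vanishes.
ΣStep-false-top : ∀ a (bs : Vec Bool k) F G →
  (∀ bs′ → weight a bs′ ℕ.+ suc a ≤ weight a bs → F bs′ ≡ 0) →
  (∀ bs′ → weight a bs′ ℕ.+ a ≡ weight a bs → fromℕ (F bs′) ≡ G bs′) →
  fromℕ (ΣStep false bs F) ≡ dropFirst bs G
ΣStep-false-top a [] F G F≡0 F≡G = refl
ΣStep-false-top a (true ∷ bs) F G F≡0 F≡G =
  cong fromℕ (ΣStep-false-≡0 (suc a) bs (F ∘ (true ∷_)) (F≡0 ∘ (true ∷_)))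
ΣStep-false-top a (false ∷ bs) F G F≡0 F≡G = begin
  fromℕ (ΣStep false bs (F ∘ (false ∷_)) ℕ.+ ΣStep true bs (F ∘ (true ∷_)))
    ≡⟨ cong₂ (λ u v → fromℕ (u ℕ.+ v))
        (ΣStep-false-≡0 (suc a) bs (F ∘ (false ∷_)) λ bs′ le → F≡0 (false ∷ bs′)
          (ℕ.≤-trans (ℕ.≤-reflexive (ℕ.+-assoc a _ (suc a))) (ℕ.+-monoʳ-≤ a le)))
        (ΣStep-true bs (F ∘ (true ∷_))) ⟩
  fromℕ (F (true ∷ bs) ℕ.+ ΣStep≢0 bs (F ∘ (true ∷_)))
    ≡⟨ cong (λ u → fromℕ (F (true ∷ bs) ℕ.+ u))
        (ΣStep≢0-≡0 (suc a) bs (F ∘ (true ∷_)) λ bs′ le → F≡0 (true ∷ bs′)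
          (ℕ.≤-trans (ℕ.≤-reflexive (e (weight (suc a) bs′) a)) (ℕ.+-monoʳ-≤ a le))) ⟩
  fromℕ (F (true ∷ bs) ℕ.+ 0)
    ≡⟨ cong fromℕ (ℕ.+-identityʳ (F (true ∷ bs))) ⟩
  fromℕ (F (true ∷ bs))
    ≡⟨ F≡G (true ∷ bs) (ℕ.+-comm (weight (suc a) bs) a) ⟩
  G (true ∷ bs) ∎
  where
  open ≡-Reasoning
  e : ∀ w a → w ℕ.+ suc a ≡ a ℕ.+ suc w
  e = ℕ-solve-∀

ΣStep≢0-moveDown : ∀ a (bs : Vec Bool k) F G →
  (∀ bs′ → suc (suc (weight a bs′)) ≤ weight a bs → F bs′ ≡ 0) →
  (∀ bs′ → suc (weight a bs′) ≡ weight a bs → fromℕ (F bs′) ≡ G bs′) →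
  fromℕ (ΣStep≢0 bs F) ≡ moveDown bs G
ΣStep≢0-moveDown a [] F G F≡0 F≡G = refl
ΣStep≢0-moveDown a (true ∷ bs) F G F≡0 F≡G = trans
  (fromℕ-+ (ΣStep≢0 bs (F ∘ (true ∷_))) (ΣStep false bs (F ∘ (false ∷_))))
  (cong₂ _+_
    (ΣStep≢0-moveDown (suc a) bs (F ∘ (true ∷_)) (G ∘ (true ∷_)) (F≡0 ∘ (true ∷_)) (F≡G ∘ (true ∷_)))
    (ΣStep-false-top (suc a) bs (F ∘ (false ∷_)) (G ∘ (false ∷_))
      (λ bs′ le → F≡0 (false ∷ bs′) (ℕ.≤-trans (ℕ.≤-reflexive (ℕ.+-comm (suc (suc a)) (weight (suc a) bs′))) le))
      (λ bs′ eq → F≡G (false ∷ bs′) (trans (ℕ.+-comm (suc a) (weight (suc a) bs′)) eq))))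
ΣStep≢0-moveDown a (false ∷ bs) F G F≡0 F≡G = ΣStep≢0-moveDown (suc a) bs (F ∘ (false ∷_)) (G ∘ (false ∷_))
  (λ bs′ le → F≡0 (false ∷ bs′) (ℕ.≤-trans (ℕ.≤-reflexive (e a (weight (suc a) bs′))) (ℕ.+-monoʳ-≤ a le)))
  (λ bs′ eq → F≡G (false ∷ bs′) (trans (sym (ℕ.+-suc a (weight (suc a) bs′))) (cong (a ℕ.+_) eq)))
  where
  e : ∀ a w → 2 ℕ.+ (a ℕ.+ w) ≡ a ℕ.+ (2 ℕ.+ w)
  e = ℕ-solve-∀

-- Moving a zero onto an occupied position would create a repeated part, where
-- G vanishes; so all decrements may be summed.

moveDown-Σpred : ∀ a (bs : Vec Bool k) (G : List ℕ → ℚ) → (∀ us x ys → G (us ++ x ∷ x ∷ ys) ≡ 0ℚ) →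
  moveDown bs (G ∘ zeros a) + dropFirst bs (λ bs′ → G (pred a ∷ zeros a bs′)) ≡ Σpred G (zeros a bs)
moveDown-Σpred a [] G G≡0 = refl
-- The position `a` holds no zero, so a zero at the next position may move there; since
-- `pred (suc a)` is `a`, this move is the boundary term of the induction hypothesis.
moveDown-Σpred a (true ∷ bs) G G≡0 = trans (ℚ.+-identityʳ _) (moveDown-Σpred (suc a) bs G G≡0)
moveDown-Σpred a (false ∷ bs) G G≡0 = begin
  moveDown bs (λ bs′ → G (a ∷ zeros (suc a) bs′)) + G (pred a ∷ zeros (suc a) bs)
    ≡⟨ ℚ.+-comm (moveDown bs (λ bs′ → G (a ∷ zeros (suc a) bs′))) _ ⟩
  G (pred a ∷ zeros (suc a) bs) + moveDown bs (λ bs′ → G (a ∷ zeros (suc a) bs′))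
    ≡⟨ cong (G (pred a ∷ zeros (suc a) bs) +_) (begin
         M                                                                 ≡⟨ ℚ.+-identityʳ M ⟨
         M + 0ℚ
           ≡⟨ cong (M +_) (trans (dropFirst-cong bs (λ bs′ → G≡0 [] a (zeros (suc a) bs′))) (dropFirst-0 bs)) ⟨
         M + dropFirst bs (λ bs′ → G (a ∷ a ∷ zeros (suc a) bs′))
           ≡⟨ moveDown-Σpred (suc a) bs (G ∘ (a ∷_)) (λ us → G≡0 (a ∷ us)) ⟩
         Σpred (G ∘ (a ∷_)) (zeros (suc a) bs)                             ∎) ⟩
  G (pred a ∷ zeros (suc a) bs) + Σpred (G ∘ (a ∷_)) (zeros (suc a) bs) ∎
  where
  open ≡-Reasoning
  M = moveDown bs (λ bs′ → G (a ∷ zeros (suc a) bs′))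

zeros-≥ : ∀ a (bs : Vec Bool k) → All (a ≤_) (zeros a bs)
zeros-≥ a []           = []
zeros-≥ a (true  ∷ bs) = All.map ℕ.<⇒≤ (zeros-≥ (suc a) bs)
zeros-≥ a (false ∷ bs) = ℕ.≤-refl ∷ All.map ℕ.<⇒≤ (zeros-≥ (suc a) bs)

zeros-increasing : ∀ a (bs : Vec Bool k) → AllPairs _<_ (zeros a bs)
zeros-increasing a []           = []
zeros-increasing a (true  ∷ bs) = zeros-increasing (suc a) bs
zeros-increasing a (false ∷ bs) = zeros-≥ (suc a) bs ∷ zeros-increasing (suc a) bs

zeros-nonZero : ∀ a (bs : Vec Bool k) → All NonZero (zeros (suc a) bs)
zeros-nonZero a bs = All.map (λ { (s≤s _) → _ }) (zeros-≥ (suc a) bs)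

weight-0 : ∀ a (bs : Vec Bool k) → weight (suc a) bs ≡ 0 → isFull bs ≡ 1 × zeros (suc a) bs ≡ []
weight-0 a []          eq = refl , refl
weight-0 a (true ∷ bs) eq = weight-0 (suc a) bs eq

-- With as many steps as weight, a step that drops more than 1 leaves too little weight for the
-- remaining ones. What is left is the sum over all decrements, and `Σpred-hook` supplies the factor
-- `suc m` that turns m! into (m+1)!.
chains-hook : ∀ m (bs : Vec Bool k) → weight 1 bs ≡ m → fromℕ (chains m bs) ≡ fromℕ (m !) * hook (zeros 1 bs)
chains-hook zero bs eq with weight-0 0 bs eq
... | full , none rewrite full | none = refl
chains-hook (suc m) bs eq = begin
  fromℕ (ΣStep false bs (chains m) ℕ.+ ΣStep≢0 bs (chains m))
    ≡⟨ fromℕ-+ (ΣStep false bs (chains m)) _ ⟩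
  fromℕ (ΣStep false bs (chains m)) + fromℕ (ΣStep≢0 bs (chains m))
    ≡⟨ cong₂ _+_
        (ΣStep-false-top 1 bs (chains m) (G ∘ zeros 1)
          (λ bs′ le → chains-≡0 m bs′ (ℕ.≤-pred (subst₂ _≤_ (ℕ.+-comm (weight 1 bs′) 2) eq le)))
          (λ bs′ e → chains-hook m bs′ (ℕ.suc-injective (trans (ℕ.+-comm 1 (weight 1 bs′)) (trans e eq)))))
        (ΣStep≢0-moveDown 1 bs (chains m) (G ∘ zeros 1)
          (λ bs′ le → chains-≡0 m bs′ (ℕ.≤-pred (subst (suc (suc (weight 1 bs′)) ≤_) eq le)))
          (λ bs′ e → chains-hook m bs′ (ℕ.suc-injective (trans e eq)))) ⟩
  dropFirst bs (G ∘ zeros 1) + moveDown bs (G ∘ zeros 1)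
    ≡⟨ ℚ.+-comm (dropFirst bs (G ∘ zeros 1)) _ ⟩
  moveDown bs (G ∘ zeros 1) + dropFirst bs (G ∘ zeros 1)
    -- Removing the zero at position 1 is written as decrementing the part 1 to 0.
    ≡⟨ cong (moveDown bs (G ∘ zeros 1) +_) (dropFirst-cong bs
        (λ bs′ → cong (fromℕ (m !) *_) (sym (hook-0∷ (zeros-nonZero 0 bs′))))) ⟩
  moveDown bs (G ∘ zeros 1) + dropFirst bs (λ bs′ → G (0 ∷ zeros 1 bs′))
    ≡⟨ moveDown-Σpred 1 bs G (λ us x ys → trans (cong (fromℕ (m !) *_) (hook-repeated us x ys))
        (ℚ.*-zeroʳ (fromℕ (m !)))) ⟩
  Σpred G (zeros 1 bs)
    ≡⟨ Σpred-*ˡ (fromℕ (m !)) hook (zeros 1 bs) ⟩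
  fromℕ (m !) * Σpred hook (zeros 1 bs)
    ≡⟨ cong (fromℕ (m !) *_) (Σpred-hook (zeros-increasing 1 bs) (zeros-nonZero 0 bs)) ⟩
  fromℕ (m !) * (fromℕ (weight 1 bs) * hook (zeros 1 bs))
    ≡⟨ cong (λ u → fromℕ (m !) * (fromℕ u * hook (zeros 1 bs))) eq ⟩
  fromℕ (m !) * (fromℕ (suc m) * hook (zeros 1 bs))
    ≡⟨ swap (fromℕ (m !)) (fromℕ (suc m)) (hook (zeros 1 bs)) ⟩
  fromℕ (suc m) * fromℕ (m !) * hook (zeros 1 bs)
    ≡⟨ cong (_* hook (zeros 1 bs)) (fromℕ-* (suc m) (m !)) ⟨
  fromℕ (suc m !) * hook (zeros 1 bs) ∎
  where
  open ≡-Reasoning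
  G : List ℕ → ℚ
  G ys = fromℕ (m !) * hook ys
  swap : ∀ a b c → a * (b * c) ≡ b * a * c
  swap = solve-∀ ℚ-ring

-- The sum of the integers from a+1 to a+k as a difference of triangular numbers, with the
-- subtracted one moved to the other side.
weight-empty : ∀ k a → weight (suc a) (empty {k}) ℕ.+ suc a C 2 ≡ (suc a ℕ.+ k) C 2
weight-empty zero    a = cong (_C 2) (sym (ℕ.+-identityʳ (suc a)))
weight-empty (suc k) a = begin
  suc a ℕ.+ w ℕ.+ suc a C 2              ≡⟨ e (suc a) w (suc a C 2) ⟩
  w ℕ.+ (suc a ℕ.+ suc a C 2)            ≡⟨ cong (λ u → w ℕ.+ (u ℕ.+ suc a C 2)) (nC1≡n (suc a)) ⟨
  w ℕ.+ (suc a C 1 ℕ.+ suc a C 2)        ≡⟨ cong (w ℕ.+_) (nCk+nC[k+1]≡[n+1]C[k+1] (suc a) 1) ⟩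
  w ℕ.+ suc (suc a) C 2                  ≡⟨ weight-empty k (suc a) ⟩
  (suc (suc a) ℕ.+ k) C 2                ≡⟨ cong (_C 2) (ℕ.+-suc (suc a) k) ⟨
  (suc a ℕ.+ suc k) C 2                  ∎
  where
  open ≡-Reasoning
  w = weight (suc (suc a)) (empty {k})
  e : ∀ a b c → a ℕ.+ b ℕ.+ c ≡ b ℕ.+ (a ℕ.+ c)
  e = ℕ-solve-∀

weight-≤ : ∀ a (bs : Vec Bool k) → weight a bs ≤ weight a (empty {k})
weight-≤ a []           = z≤n
weight-≤ a (true  ∷ bs) = ℕ.≤-trans (weight-≤ (suc a) bs) (ℕ.m≤n+m _ a)
weight-≤ a (false ∷ bs) = ℕ.+-monoʳ-≤ a (weight-≤ (suc a) bs)

-- The Newton expansion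

Σ< : ℕ → (ℕ → ℕ) → ℕ
Σ< zero    f = 0
Σ< (suc n) f = Σ< n f ℕ.+ f n

Σ<-cong : ∀ n {f g} → f ≗ g → Σ< n f ≡ Σ< n g
Σ<-cong zero    eq = refl
Σ<-cong (suc n) eq = cong₂ ℕ._+_ (Σ<-cong n eq) (eq n)

Σ<-head : ∀ n f → Σ< (suc n) f ≡ f 0 ℕ.+ Σ< n (f ∘ suc)
Σ<-head zero    f = ℕ.+-comm 0 (f 0)
Σ<-head (suc n) f = trans (cong (ℕ._+ f (suc n)) (Σ<-head n f)) (ℕ.+-assoc (f 0) _ _)

Σ<-+ : ∀ n f g → Σ< n (λ m → f m ℕ.+ g m) ≡ Σ< n f ℕ.+ Σ< n g
Σ<-+ zero    f g = refl
Σ<-+ (suc n) f g = trans (cong (ℕ._+ (f n ℕ.+ g n)) (Σ<-+ n f g)) (e (Σ< n f) (Σ< n g) (f n) (g n))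
  where
  e : ∀ a b c d → a ℕ.+ b ℕ.+ (c ℕ.+ d) ≡ a ℕ.+ c ℕ.+ (b ℕ.+ d)
  e = ℕ-solve-∀

Σ<-0 : ∀ n → Σ< n (λ _ → 0) ≡ 0
Σ<-0 zero    = refl
Σ<-0 (suc n) = trans (ℕ.+-identityʳ _) (Σ<-0 n)

advance-0 : ∀ (bs : Vec Bool k) → advance bs (λ _ → 0) ≡ 0
advance-0 bs = cong₂ ℕ._+_ (ΣStep-false-≡0 0 bs (λ _ → 0) (λ _ _ → refl)) (ΣStep≢0-≡0 0 bs (λ _ → 0) (λ _ _ → refl))

advance-Σ< : ∀ n (w : ℕ → ℕ) (F : ℕ → Vec Bool k → ℕ) bs →
             advance bs (λ b → Σ< n (λ m → w m ℕ.* F m b)) ≡ Σ< n (λ m → w m ℕ.* advance bs (F m))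
advance-Σ< zero    w F bs = advance-0 bs
advance-Σ< (suc n) w F bs = trans (advance-linear bs (λ b → Σ< n (λ m → w m ℕ.* F m b)) (w n) (F n))
  (cong (ℕ._+ w n ℕ.* advance bs (F n)) (advance-Σ< n w F bs))

-- Pascal's rule matches the forward difference. The upper limit is the largest weight of any state,
-- the same for all `bs`, so that the induction hypothesis can be inserted under `advance`, which
-- passes to other states.
completions-newton : ∀ n (bs : Vec Bool k) →
  completions n bs ≡ Σ< (suc (weight 1 (empty {k}))) (λ m → (n C m) ℕ.* chains m bs)
completions-newton {k} zero bs = begin
  isFull bs                                        ≡⟨ ℕ.+-identityʳ (isFull bs) ⟨
  isFull bs ℕ.+ 0                                  ≡⟨ cong₂ ℕ._+_ (ℕ.*-identityˡ (isFull bs)) (Σ<-0 N) ⟨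
  1 ℕ.* isFull bs ℕ.+ Σ< N (λ _ → 0)
    ≡⟨ cong (1 ℕ.* isFull bs ℕ.+_) (Σ<-cong N (λ m → cong (ℕ._* chains (suc m) bs)
        (sym (k>n⇒nCk≡0 {0} {suc m} (s≤s z≤n))))) ⟩
  1 ℕ.* isFull bs ℕ.+ Σ< N (λ m → (0 C suc m) ℕ.* chains (suc m) bs) ≡⟨ Σ<-head N (λ m → (0 C m) ℕ.* chains m bs) ⟨
  Σ< (suc N) (λ m → (0 C m) ℕ.* chains m bs)       ∎
  where
  open ≡-Reasoning
  N = weight 1 (empty {k})
completions-newton {k} (suc n) bs = begin
  completions (suc n) bs
    ≡⟨ completions-suc n bs ⟩
  completions n bs ℕ.+ advance bs (completions n)
    ≡⟨ cong₂ ℕ._+_ (completions-newton n bs) (trans (advance-cong bs (completions-newton n))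
        (advance-Σ< (suc N) (n C_) chains bs)) ⟩
  Σ< (suc N) f ℕ.+ (Σ< N g ℕ.+ (n C N) ℕ.* chains (suc N) bs)
    -- `advance` shifts the index by one; the overflowing term N+1 vanishes because no state has
    -- weight above `N`.
    ≡⟨ cong₂ (λ u v → u ℕ.+ (Σ< N g ℕ.+ v)) (Σ<-head N f)
         (trans (cong ((n C N) ℕ.*_) (chains-≡0 (suc N) bs (s≤s (weight-≤ 1 bs)))) (ℕ.*-zeroʳ (n C N))) ⟩
  (f 0 ℕ.+ Σ< N (f ∘ suc)) ℕ.+ (Σ< N g ℕ.+ 0)
    ≡⟨ e (f 0) (Σ< N (f ∘ suc)) (Σ< N g) ⟩
  f 0 ℕ.+ (Σ< N g ℕ.+ Σ< N (f ∘ suc))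
    ≡⟨ cong (f 0 ℕ.+_) (Σ<-+ N g (f ∘ suc)) ⟨
  f 0 ℕ.+ Σ< N (λ m → g m ℕ.+ f (suc m))
    ≡⟨ cong (f 0 ℕ.+_) (Σ<-cong N (λ m → trans (sym (ℕ.*-distribʳ-+ (chains (suc m) bs) (n C m) (n C suc m)))
         (cong (ℕ._* chains (suc m) bs) (nCk+nC[k+1]≡[n+1]C[k+1] n m)))) ⟩
  f 0 ℕ.+ Σ< N (λ m → (suc n C suc m) ℕ.* chains (suc m) bs)
    ≡⟨ Σ<-head N (λ m → (suc n C m) ℕ.* chains m bs) ⟨
  Σ< (suc N) (λ m → (suc n C m) ℕ.* chains m bs) ∎
  where
  open ≡-Reasoning
  N = weight 1 (empty {k})
  f g : ℕ → ℕ
  f m = (n C m) ℕ.* chains m bs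
  g m = (n C m) ℕ.* chains (suc m) bs
  e : ∀ a b c → (a ℕ.+ b) ℕ.+ (c ℕ.+ 0) ≡ a ℕ.+ (c ℕ.+ b)
  e = ℕ-solve-∀

-- The hook product of the staircase

fromℕ-!≢0 : ∀ n → fromℕ (n !) ≢ 0ℚ
fromℕ-!≢0 n = fromℕ≢0 (n !) {{n ℕ.!≢0}}

!/!-cancel : ∀ a b → a !/ b ! * fromℕ (b !) ≡ fromℕ (a !)
!/!-cancel a b = /-*-cancel (a !) (b !) {{b ℕ.!≢0}}

!/!-self : ∀ a → a !/ a ! ≡ 1ℚ
!/!-self a = *-cancelʳ (fromℕ (a !)) (fromℕ-!≢0 a) (trans (!/!-cancel a a) (sym (ℚ.*-identityˡ _)))

∏-snoc : ∀ n f → ∏ (suc n) f ≡ ∏ n f * f n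
∏-snoc zero    f = ℚ.*-comm (f 0) 1ℚ
∏-snoc (suc n) f = trans (cong (f 0 *_) (∏-snoc n (f ∘ suc))) (sym (ℚ.*-assoc (f 0) _ _))

∏≢0 : ∀ n f → (∀ i → f i ≢ 0ℚ) → ∏ n f ≢ 0ℚ
∏≢0 zero    f f≢0 = λ ()
∏≢0 (suc n) f f≢0 = *≢0 (f≢0 0) (∏≢0 n (f ∘ suc) (f≢0 ∘ suc))

!/!≢0 : ∀ a b → a !/ b ! ≢ 0ℚ
!/!≢0 a b eq = fromℕ-!≢0 a (trans (sym (!/!-cancel a b))
    (trans (cong (_* fromℕ (b !)) eq) (ℚ.*-zeroˡ (fromℕ (b !)))))

-- The numerators run from t+1 to t+j and the denominators from 2a+t+1 to 2a+t+j, so both products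
-- are quotients of factorials, cleared of denominators here. The gap `t` is free for the induction
-- and 0 in the application.
∏ₗ-pair-interval : ∀ j {a s t} → s ≡ suc (a ℕ.+ t) →
  ∏ₗ (pair a) (zeros s (empty {j})) * (fromℕ (t !) * fromℕ ((2 ℕ.* a ℕ.+ t ℕ.+ j) !))
  ≡ fromℕ ((t ℕ.+ j) !) * fromℕ ((2 ℕ.* a ℕ.+ t) !)
∏ₗ-pair-interval zero {a} {s} {t} s≡ = trans (ℚ.*-identityˡ _)
  (cong₂ (λ u v → fromℕ (u !) * fromℕ (v !)) (sym (ℕ.+-identityʳ t)) (ℕ.+-identityʳ (2 ℕ.* a ℕ.+ t)))
∏ₗ-pair-interval (suc j) {a} {s} {t} s≡ = begin
  pair a s * R * (fromℕ (t !) * F)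
    ≡⟨ cong₂ (λ u v → u * inv v * R * (fromℕ (t !) * F)) d≡ s+a≡ ⟩
  fromℕ (suc t) * inv V * R * (fromℕ (t !) * F)
    ≡⟨ regroup₁ (fromℕ (suc t)) (inv V) R (fromℕ (t !)) F ⟩
  inv V * (R * (fromℕ (suc t) * fromℕ (t !) * F))
    ≡⟨ cong₂ (λ u v → inv V * (R * (u * fromℕ (v !)))) (sym (fromℕ-* (suc t) (t !))) (e₁ a t j) ⟩
  inv V * (R * (fromℕ (suc t !) * fromℕ ((2 ℕ.* a ℕ.+ suc t ℕ.+ j) !)))
    ≡⟨ cong (inv V *_) (∏ₗ-pair-interval j {a} {suc s} {suc t} (cong suc (trans s≡ (sym (ℕ.+-suc a t))))) ⟩
  inv V * (fromℕ ((suc t ℕ.+ j) !) * fromℕ ((2 ℕ.* a ℕ.+ suc t) !))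
    ≡⟨ cong₂ (λ u v → inv V * (fromℕ (u !) * v)) (sym (ℕ.+-suc t j))
         (trans (cong (λ u → fromℕ (u !)) (ℕ.+-suc (2 ℕ.* a) t))
             (fromℕ-* (suc (2 ℕ.* a ℕ.+ t)) ((2 ℕ.* a ℕ.+ t) !))) ⟩
  inv V * (fromℕ ((t ℕ.+ suc j) !) * (V * W))
    ≡⟨ regroup₂ (inv V) (fromℕ ((t ℕ.+ suc j) !)) V W ⟩
  V * inv V * (fromℕ ((t ℕ.+ suc j) !) * W)
    ≡⟨ cong (_* (fromℕ ((t ℕ.+ suc j) !) * W)) (inv-cancel (fromℕ≢0 (suc (2 ℕ.* a ℕ.+ t)))) ⟩
  1ℚ * (fromℕ ((t ℕ.+ suc j) !) * W)
    ≡⟨ ℚ.*-identityˡ _ ⟩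
  fromℕ ((t ℕ.+ suc j) !) * W ∎
  where
  open ≡-Reasoning
  R = ∏ₗ (pair a) (zeros (suc s) (empty {j}))
  F = fromℕ ((2 ℕ.* a ℕ.+ t ℕ.+ suc j) !)
  V = fromℕ (suc (2 ℕ.* a ℕ.+ t))
  W = fromℕ ((2 ℕ.* a ℕ.+ t) !)
  e₀ : ∀ a t → a + t - a ≡ t
  e₀ = solve-∀ ℚ-ring
  d≡ : fromℕ s - fromℕ a ≡ fromℕ (suc t)
  d≡ = trans (cong (_- fromℕ a) (trans (cong fromℕ (trans s≡ (sym (ℕ.+-suc a t)))) (fromℕ-+ a (suc t))))
      (e₀ (fromℕ a) (fromℕ (suc t)))
  e₂ : ∀ a t → suc (a ℕ.+ t) ℕ.+ a ≡ suc (2 ℕ.* a ℕ.+ t)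
  e₂ = ℕ-solve-∀
  s+a≡ : fromℕ s + fromℕ a ≡ V
  s+a≡ = trans (sym (fromℕ-+ s a)) (cong fromℕ (trans (cong (ℕ._+ a) s≡) (e₂ a t)))
  e₁ : ∀ a t j → 2 ℕ.* a ℕ.+ t ℕ.+ suc j ≡ 2 ℕ.* a ℕ.+ suc t ℕ.+ j
  e₁ = ℕ-solve-∀
  regroup₁ : ∀ d i R f F → d * i * R * (f * F) ≡ i * (R * (d * f * F))
  regroup₁ = solve-∀ ℚ-ring
  regroup₂ : ∀ i f v w → i * (f * (v * w)) ≡ v * i * (f * w)
  regroup₂ = solve-∀ ℚ-ring

∏ₗ-pair-staircase : ∀ j a → ∏ₗ (pair a) (zeros (suc a) (empty {j})) ≡ fromℕ (j !) * ((2 ℕ.* a) !/ (2 ℕ.* a ℕ.+ j) !)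
∏ₗ-pair-staircase j a = *-cancelʳ F (fromℕ-!≢0 (2 ℕ.* a ℕ.+ j)) (begin
  R * F
    ≡⟨ cong₂ (λ u v → u * fromℕ (v !)) (sym (ℚ.*-identityʳ R)) (cong (ℕ._+ j) (sym (ℕ.+-identityʳ (2 ℕ.* a)))) ⟩
  R * 1ℚ * fromℕ ((2 ℕ.* a ℕ.+ 0 ℕ.+ j) !)
    ≡⟨ ℚ.*-assoc R 1ℚ _ ⟩
  R * (1ℚ * fromℕ ((2 ℕ.* a ℕ.+ 0 ℕ.+ j) !))
    ≡⟨ ∏ₗ-pair-interval j {a} {suc a} {0} (cong suc (sym (ℕ.+-identityʳ a))) ⟩
  fromℕ (j !) * fromℕ ((2 ℕ.* a ℕ.+ 0) !)
    ≡⟨ cong (λ u → fromℕ (j !) * fromℕ (u !)) (ℕ.+-identityʳ (2 ℕ.* a)) ⟩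
  fromℕ (j !) * fromℕ ((2 ℕ.* a) !)
    ≡⟨ cong (fromℕ (j !) *_) (!/!-cancel (2 ℕ.* a) (2 ℕ.* a ℕ.+ j)) ⟨
  fromℕ (j !) * ((2 ℕ.* a) !/ (2 ℕ.* a ℕ.+ j) ! * F)
    ≡⟨ ℚ.*-assoc (fromℕ (j !)) _ F ⟨
  fromℕ (j !) * ((2 ℕ.* a) !/ (2 ℕ.* a ℕ.+ j) !) * F ∎)
  where
  open ≡-Reasoning
  R = ∏ₗ (pair a) (zeros (suc a) (empty {j}))
  F = fromℕ ((2 ℕ.* a ℕ.+ j) !)

superfactorial : ℕ → ℚ
superfactorial n = ∏ n (λ i → fromℕ (i !))

-- The part b contributes (K-b)! (2b)! / (b! (K+b)!). Over b from a+1 to K the factors (K-b)!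
-- multiply to `superfactorial j`, and the other two products are quotients of products starting at
-- 0, whose divisors are moved across.
hook-empty-step : ∀ j a K → a ℕ.+ j ≡ K →
  hook (zeros (suc a) (empty {j})) * (superfactorial (suc K) * ∏ (suc a) (λ i → (2 ℕ.* i) !/ (K ℕ.+ i) !))
  ≡ superfactorial j * superfactorial (suc a) * ∏ (suc K) (λ i → (2 ℕ.* i) !/ (K ℕ.+ i) !)
hook-empty-step zero a K a+0≡K with refl ← trans (sym (ℕ.+-identityʳ a)) a+0≡K =
  sym (ℚ.*-assoc 1ℚ (superfactorial (suc a)) _)
hook-empty-step (suc j) a K a+j≡K = begin
  i * R * H * (S * G)
    ≡⟨ cong (λ u → i * u * H * (S * G)) (trans (∏ₗ-pair-staircase j (suc a))
        (cong (λ u → fromℕ (j !) * ((2 ℕ.* suc a) !/ u !)) index)) ⟩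
  i * (fromℕ (j !) * g (suc a)) * H * (S * G)
    ≡⟨ regroup₁ i (fromℕ (j !)) (g (suc a)) H S G ⟩
  i * fromℕ (j !) * (H * (S * (G * g (suc a))))
    ≡⟨ cong (λ u → i * fromℕ (j !) * (H * (S * u))) (∏-snoc (suc a) g) ⟨
  i * fromℕ (j !) * (H * (S * ∏ (suc (suc a)) g))
    ≡⟨ cong (i * fromℕ (j !) *_) (hook-empty-step j (suc a) K (trans (sym (ℕ.+-suc a j)) a+j≡K)) ⟩
  i * fromℕ (j !) * (superfactorial j * superfactorial (suc (suc a)) * T)
    ≡⟨ cong (λ u → i * fromℕ (j !) * (superfactorial j * u * T)) (∏-snoc (suc a) (λ i → fromℕ (i !))) ⟩
  i * fromℕ (j !) * (superfactorial j * (superfactorial (suc a) * f) * T)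
    ≡⟨ regroup₂ i (fromℕ (j !)) (superfactorial j) (superfactorial (suc a)) f T ⟩
  f * i * (superfactorial j * fromℕ (j !) * superfactorial (suc a) * T)
    ≡⟨ cong (_* (superfactorial j * fromℕ (j !) * superfactorial (suc a) * T)) (inv-cancel (fromℕ-!≢0 (suc a))) ⟩
  1ℚ * (superfactorial j * fromℕ (j !) * superfactorial (suc a) * T)
    ≡⟨ ℚ.*-identityˡ _ ⟩
  superfactorial j * fromℕ (j !) * superfactorial (suc a) * T
    ≡⟨ cong (λ u → u * superfactorial (suc a) * T) (∏-snoc j (λ i → fromℕ (i !))) ⟨
  superfactorial (suc j) * superfactorial (suc a) * T ∎
  where
  open ≡-Reasoning
  g : ℕ → ℚ
  g i = (2 ℕ.* i) !/ (K ℕ.+ i) !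
  f = fromℕ (suc a !)
  i = inv f
  R = ∏ₗ (pair (suc a)) (zeros (suc (suc a)) (empty {j}))
  H = hook (zeros (suc (suc a)) (empty {j}))
  S = superfactorial (suc K)
  G = ∏ (suc a) g
  T = ∏ (suc K) g
  e : ∀ a j → 2 ℕ.* suc a ℕ.+ j ≡ a ℕ.+ suc j ℕ.+ suc a
  e = ℕ-solve-∀
  index : 2 ℕ.* suc a ℕ.+ j ≡ K ℕ.+ suc a
  index = trans (e a j) (cong (ℕ._+ suc a) a+j≡K)
  regroup₁ : ∀ i f g H S G → i * (f * g) * H * (S * G) ≡ i * f * (H * (S * (G * g)))
  regroup₁ = solve-∀ ℚ-ring
  regroup₂ : ∀ i f s t g T → i * f * (s * (t * g) * T) ≡ g * i * (s * f * t * T)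
  regroup₂ = solve-∀ ℚ-ring

-- The parts give the factors with index 1 to k, the claim has 0 to k-1. The factor at k is 1, and
-- the one at 0 is 1/k!, which cancels the surplus k! of `superfactorial (suc k)`.
hook-empty : ∀ k → hook (zeros 1 (empty {k})) ≡ ∏ k (λ i → (2 ℕ.* i) !/ (k ℕ.+ i) !)
hook-empty k = *-cancelʳ S (∏≢0 k (λ i → fromℕ (i !)) fromℕ-!≢0) (begin
  H * S                                   ≡⟨ cong (H *_) (ℚ.*-identityʳ S) ⟨
  H * (S * 1ℚ)                            ≡⟨ cong (λ u → H * (S * u)) (trans (ℚ.*-comm (fromℕ (k !)) (g 0)) g0) ⟨
  H * (S * (fromℕ (k !) * g 0))           ≡⟨ regroup H S (fromℕ (k !)) (g 0) ⟩
  H * (S * fromℕ (k !) * (g 0 * 1ℚ))      ≡⟨ cong (λ u → H * (u * (g 0 * 1ℚ))) (∏-snoc k (λ i → fromℕ (i !))) ⟨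
  H * (superfactorial (suc k) * ∏ 1 g)    ≡⟨ hook-empty-step k 0 k refl ⟩
  S * 1ℚ * ∏ (suc k) g                    ≡⟨ cong (S * 1ℚ *_) (∏-snoc k g) ⟩
  S * 1ℚ * (∏ k g * g k)                  ≡⟨ cong (λ u → S * 1ℚ * (∏ k g * u)) gk ⟩
  S * 1ℚ * (∏ k g * 1ℚ)                   ≡⟨ simplify S (∏ k g) ⟩
  ∏ k g * S                               ∎)
  where
  open ≡-Reasoning
  H = hook (zeros 1 (empty {k}))
  S = superfactorial k
  g : ℕ → ℚ
  g i = (2 ℕ.* i) !/ (k ℕ.+ i) !
  g0 : g 0 * fromℕ (k !) ≡ 1ℚ
  g0 = trans (cong (λ u → 0 !/ u ! * fromℕ (k !)) (ℕ.+-identityʳ k)) (!/!-cancel 0 k)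
  gk : g k ≡ 1ℚ
  gk = trans (cong (λ u → (2 ℕ.* k) !/ (k ℕ.+ u) !) (sym (ℕ.+-identityʳ k))) (!/!-self (2 ℕ.* k))
  regroup : ∀ H S f g → H * (S * (f * g)) ≡ H * (S * f * (g * 1ℚ))
  regroup = solve-∀ ℚ-ring
  simplify : ∀ S P → S * 1ℚ * (P * 1ℚ) ≡ P * S
  simplify = solve-∀ ℚ-ring

-- Polynomials

_+ᵖ_ : Polynomial → Polynomial → Polynomial
[]      +ᵖ q       = q
(a ∷ p) +ᵖ []      = a ∷ p
(a ∷ p) +ᵖ (b ∷ q) = a + b ∷ p +ᵖ q

_*ᵖ_ : ℚ → Polynomial → Polynomial
c *ᵖ p = List.map (c *_) p

eval-+ᵖ : ∀ p q x → eval (p +ᵖ q) x ≡ eval p x + eval q x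
eval-+ᵖ []      q       x = sym (ℚ.+-identityˡ _)
eval-+ᵖ (a ∷ p) []      x = sym (ℚ.+-identityʳ _)
eval-+ᵖ (a ∷ p) (b ∷ q) x = trans (cong (λ u → a + b + x * u) (eval-+ᵖ p q x)) (e a b x (eval p x) (eval q x))
  where
  e : ∀ a b x p q → a + b + x * (p + q) ≡ a + x * p + (b + x * q)
  e = solve-∀ ℚ-ring

coeff-+ᵖ : ∀ p q i → coeff (p +ᵖ q) i ≡ coeff p i + coeff q i
coeff-+ᵖ []      q       i       = sym (ℚ.+-identityˡ _)
coeff-+ᵖ (a ∷ p) []      i       = sym (ℚ.+-identityʳ _)
coeff-+ᵖ (a ∷ p) (b ∷ q) zero    = refl
coeff-+ᵖ (a ∷ p) (b ∷ q) (suc i) = coeff-+ᵖ p q i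

eval-*ᵖ : ∀ c p x → eval (c *ᵖ p) x ≡ c * eval p x
eval-*ᵖ c []      x = sym (ℚ.*-zeroʳ c)
eval-*ᵖ c (a ∷ p) x = trans (cong (λ u → c * a + x * u) (eval-*ᵖ c p x)) (e c a x (eval p x))
  where
  e : ∀ c a x p → c * a + x * (c * p) ≡ c * (a + x * p)
  e = solve-∀ ℚ-ring

coeff-*ᵖ : ∀ c p i → coeff (c *ᵖ p) i ≡ c * coeff p i
coeff-*ᵖ c []      i       = sym (ℚ.*-zeroʳ c)
coeff-*ᵖ c (a ∷ p) zero    = refl
coeff-*ᵖ c (a ∷ p) (suc i) = coeff-*ᵖ c p i

[x-_]*_ : ℚ → Polynomial → Polynomial
[x- c ]* p = (0ℚ ∷ p) +ᵖ ((- c) *ᵖ p)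

eval-[x-]* : ∀ c p x → eval ([x- c ]* p) x ≡ (x - c) * eval p x
eval-[x-]* c p x = begin
  eval ((0ℚ ∷ p) +ᵖ ((- c) *ᵖ p)) x           ≡⟨ eval-+ᵖ (0ℚ ∷ p) ((- c) *ᵖ p) x ⟩
  0ℚ + x * eval p x + eval ((- c) *ᵖ p) x     ≡⟨ cong (λ u → 0ℚ + x * eval p x + u) (eval-*ᵖ (- c) p x) ⟩
  0ℚ + x * eval p x + (- c) * eval p x        ≡⟨ e x c (eval p x) ⟩
  (x - c) * eval p x                          ∎
  where
  open ≡-Reasoning
  e : ∀ x c p → 0ℚ + x * p + (- c) * p ≡ (x - c) * p
  e = solve-∀ ℚ-ring

coeff-[x-]* : ∀ c p i → coeff ([x- c ]* p) (suc i) ≡ coeff p i + (- c) * coeff p (suc i)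
coeff-[x-]* c p i = trans (coeff-+ᵖ (0ℚ ∷ p) ((- c) *ᵖ p) (suc i))
  (cong (λ u → coeff p i + u) (coeff-*ᵖ (- c) p (suc i)))

binomial : ℕ → Polynomial
binomial zero    = 1ℚ ∷ []
binomial (suc m) = inv (fromℕ (suc m)) *ᵖ ([x- fromℕ m ]* binomial m)

-- The absorption rule (m+1) C(n,m+1) = (n-m) C(n,m), arranged without truncated subtraction so that
-- it holds for all `n` and `m`.
C-absorb : ∀ n m → suc m ℕ.* (n C suc m) ℕ.+ m ℕ.* (n C m) ≡ n ℕ.* (n C m)
C-absorb zero    zero    = refl
C-absorb zero    (suc m) = cong₂ ℕ._+_
  (trans (cong (suc (suc m) ℕ.*_) (k>n⇒nCk≡0 {0} {suc (suc m)} (s≤s z≤n))) (ℕ.*-zeroʳ (suc (suc m))))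
  (trans (cong (suc m ℕ.*_) (k>n⇒nCk≡0 {0} {suc m} (s≤s z≤n))) (ℕ.*-zeroʳ (suc m)))
C-absorb (suc n) zero    = trans (cong (λ u → 1 ℕ.* u ℕ.+ 0) (nC1≡n (suc n))) (e n)
  where
  e : ∀ n → 1 ℕ.* suc n ℕ.+ 0 ≡ suc n ℕ.* 1
  e = ℕ-solve-∀
C-absorb (suc n) (suc m) = begin
  suc (suc m) ℕ.* (suc n C suc (suc m)) ℕ.+ suc m ℕ.* (suc n C suc m)
    ≡⟨ cong₂ (λ u v → suc (suc m) ℕ.* u ℕ.+ suc m ℕ.* v) (nCk+nC[k+1]≡[n+1]C[k+1] n (suc m))
        (nCk+nC[k+1]≡[n+1]C[k+1] n m) ⟨
  suc (suc m) ℕ.* (b ℕ.+ d) ℕ.+ suc m ℕ.* (a ℕ.+ b)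
    ≡⟨ e₁ m a b d ⟩
  (suc (suc m) ℕ.* d ℕ.+ suc m ℕ.* b) ℕ.+ (suc m ℕ.* b ℕ.+ m ℕ.* a) ℕ.+ (a ℕ.+ b)
    ≡⟨ cong₂ (λ u v → u ℕ.+ v ℕ.+ (a ℕ.+ b)) (C-absorb n (suc m)) (C-absorb n m) ⟩
  n ℕ.* b ℕ.+ n ℕ.* a ℕ.+ (a ℕ.+ b)
    ≡⟨ e₂ n a b ⟩
  suc n ℕ.* (a ℕ.+ b)
    ≡⟨ cong (suc n ℕ.*_) (nCk+nC[k+1]≡[n+1]C[k+1] n m) ⟩
  suc n ℕ.* (suc n C suc m) ∎
  where
  open ≡-Reasoning
  a = n C m
  b = n C suc m
  d = n C suc (suc m)
  e₁ : ∀ m a b d → suc (suc m) ℕ.* (b ℕ.+ d) ℕ.+ suc m ℕ.* (a ℕ.+ b)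
     ≡ (suc (suc m) ℕ.* d ℕ.+ suc m ℕ.* b) ℕ.+ (suc m ℕ.* b ℕ.+ m ℕ.* a) ℕ.+ (a ℕ.+ b)
  e₁ = ℕ-solve-∀
  e₂ : ∀ n a b → n ℕ.* b ℕ.+ n ℕ.* a ℕ.+ (a ℕ.+ b) ≡ suc n ℕ.* (a ℕ.+ b)
  e₂ = ℕ-solve-∀

eval-binomial : ∀ m n → eval (binomial m) (fromℕ n) ≡ fromℕ (n C m)
eval-binomial zero    n = trans (cong (λ u → 1ℚ + u) (ℚ.*-zeroʳ (fromℕ n))) refl
eval-binomial (suc m) n = begin
  eval (i *ᵖ ([x- fromℕ m ]* p)) x
    ≡⟨ eval-*ᵖ i ([x- fromℕ m ]* p) x ⟩
  i * eval ([x- fromℕ m ]* p) x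
    ≡⟨ cong (i *_) (trans (eval-[x-]* (fromℕ m) p x) (cong ((x - fromℕ m) *_) (eval-binomial m n))) ⟩
  i * ((x - fromℕ m) * b)
    ≡⟨ e₁ i x b (fromℕ m) ⟩
  i * (x * b - fromℕ m * b)
    ≡⟨ cong (λ u → i * (u - fromℕ m * b)) absorb ⟨
  i * (M * b′ + fromℕ m * b - fromℕ m * b)
    ≡⟨ e₂ i M b′ (fromℕ m * b) ⟩
  M * i * b′
    ≡⟨ cong (_* b′) (inv-cancel (fromℕ≢0 (suc m))) ⟩
  1ℚ * b′
    ≡⟨ ℚ.*-identityˡ b′ ⟩
  b′ ∎
  where
  open ≡-Reasoning
  x = fromℕ n
  M = fromℕ (suc m)
  i = inv M
  p = binomial m
  b = fromℕ (n C m)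
  b′ = fromℕ (n C suc m)
  absorb : M * b′ + fromℕ m * b ≡ x * b
  absorb = begin
    M * b′ + fromℕ m * b
      ≡⟨ cong₂ _+_ (fromℕ-* (suc m) (n C suc m)) (fromℕ-* m (n C m)) ⟨
    fromℕ (suc m ℕ.* (n C suc m)) + fromℕ (m ℕ.* (n C m))       ≡⟨ fromℕ-+ (suc m ℕ.* (n C suc m)) (m ℕ.* (n C m)) ⟨
    fromℕ (suc m ℕ.* (n C suc m) ℕ.+ m ℕ.* (n C m))             ≡⟨ cong fromℕ (C-absorb n m) ⟩
    fromℕ (n ℕ.* (n C m))                                       ≡⟨ fromℕ-* n (n C m) ⟩
    x * b                                                       ∎
  e₁ : ∀ i x b m → i * ((x - m) * b) ≡ i * (x * b - m * b)
  e₁ = solve-∀ ℚ-ring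
  e₂ : ∀ i M b d → i * (M * b + d - d) ≡ M * i * b
  e₂ = solve-∀ ℚ-ring

coeff-binomial-suc : ∀ m i → coeff (binomial (suc m)) (suc i)
  ≡ inv (fromℕ (suc m)) * (coeff (binomial m) i + (- fromℕ m) * coeff (binomial m) (suc i))
coeff-binomial-suc m i = trans
  (coeff-*ᵖ (inv (fromℕ (suc m))) ([x- fromℕ m ]* binomial m) (suc i))
  (cong (inv (fromℕ (suc m)) *_) (coeff-[x-]* (fromℕ m) (binomial m) i))

coeff-binomial-> : ∀ m i → m < i → coeff (binomial m) i ≡ 0ℚ
coeff-binomial-> zero    (suc i) _         = refl
coeff-binomial-> (suc m) (suc i) (s≤s m<i) = trans (coeff-binomial-suc m i)
  (trans (cong₂ (λ u v → inv (fromℕ (suc m)) * (u + (- fromℕ m) * v)) (coeff-binomial-> m i m<i)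
      (coeff-binomial-> m (suc i) (ℕ.m<n⇒m<1+n m<i)))
         (e (inv (fromℕ (suc m))) (- fromℕ m)))
  where
  e : ∀ i m → i * (0ℚ + m * 0ℚ) ≡ 0ℚ
  e = solve-∀ ℚ-ring

coeff-binomial : ∀ m → coeff (binomial m) m ≡ inv (fromℕ (m !))
coeff-binomial zero    = refl
coeff-binomial (suc m) = begin
  coeff (binomial (suc m)) (suc m)
    ≡⟨ coeff-binomial-suc m m ⟩
  i * (coeff (binomial m) m + (- fromℕ m) * coeff (binomial m) (suc m))
    ≡⟨ cong₂ (λ u v → i * (u + (- fromℕ m) * v)) (coeff-binomial m) (coeff-binomial-> m (suc m) ℕ.≤-refl) ⟩
  i * (inv (fromℕ (m !)) + (- fromℕ m) * 0ℚ)
    ≡⟨ e i (inv (fromℕ (m !))) (- fromℕ m) ⟩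
  i * inv (fromℕ (m !))
    ≡⟨ inv-* (fromℕ≢0 (suc m)) (fromℕ-!≢0 m) ⟨
  inv (fromℕ (suc m) * fromℕ (m !))
    ≡⟨ cong inv (fromℕ-* (suc m) (m !)) ⟨
  inv (fromℕ (suc m !)) ∎
  where
  open ≡-Reasoning
  i = inv (fromℕ (suc m))
  e : ∀ i f m → i * (f + m * 0ℚ) ≡ i * f
  e = solve-∀ ℚ-ring

newton : ℕ → (ℕ → ℕ) → Polynomial
newton zero    s = []
newton (suc n) s = newton n s +ᵖ (fromℕ (s n) *ᵖ binomial n)

eval-newton : ∀ L s n → eval (newton L s) (fromℕ n) ≡ fromℕ (Σ< L (λ m → (n C m) ℕ.* s m))
eval-newton zero    s n = refl
eval-newton (suc L) s n = begin
  eval (newton L s +ᵖ (fromℕ (s L) *ᵖ binomial L)) x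
    ≡⟨ eval-+ᵖ (newton L s) _ x ⟩
  eval (newton L s) x + eval (fromℕ (s L) *ᵖ binomial L) x
    ≡⟨ cong₂ _+_ (eval-newton L s n) (trans (eval-*ᵖ (fromℕ (s L)) (binomial L) x)
        (cong (fromℕ (s L) *_) (eval-binomial L n))) ⟩
  fromℕ Σ + fromℕ (s L) * fromℕ (n C L)
    ≡⟨ cong (λ u → fromℕ Σ + u) (trans (ℚ.*-comm (fromℕ (s L)) (fromℕ (n C L))) (sym (fromℕ-* (n C L) (s L)))) ⟩
  fromℕ Σ + fromℕ ((n C L) ℕ.* s L)
    ≡⟨ fromℕ-+ Σ ((n C L) ℕ.* s L) ⟨
  fromℕ (Σ ℕ.+ (n C L) ℕ.* s L) ∎
  where
  open ≡-Reasoning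
  x = fromℕ n
  Σ = Σ< L (λ m → (n C m) ℕ.* s m)

coeff-newton-≥ : ∀ L s i → L ≤ i → coeff (newton L s) i ≡ 0ℚ
coeff-newton-≥ zero    s i _   = refl
coeff-newton-≥ (suc L) s i L<i = begin
  coeff (newton L s +ᵖ (fromℕ (s L) *ᵖ binomial L)) i
    ≡⟨ coeff-+ᵖ (newton L s) _ i ⟩
  coeff (newton L s) i + coeff (fromℕ (s L) *ᵖ binomial L) i
    ≡⟨ cong₂ _+_ (coeff-newton-≥ L s i (ℕ.<⇒≤ L<i)) (trans (coeff-*ᵖ (fromℕ (s L)) (binomial L) i)
         (trans (cong (fromℕ (s L) *_) (coeff-binomial-> L i L<i)) (ℚ.*-zeroʳ (fromℕ (s L))))) ⟩
  0ℚ + 0ℚ ∎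
  where open ≡-Reasoning

coeff-newton : ∀ L s → coeff (newton (suc L) s) L ≡ fromℕ (s L) * inv (fromℕ (L !))
coeff-newton L s = begin
  coeff (newton L s +ᵖ (fromℕ (s L) *ᵖ binomial L)) L
    ≡⟨ coeff-+ᵖ (newton L s) _ L ⟩
  coeff (newton L s) L + coeff (fromℕ (s L) *ᵖ binomial L) L
    ≡⟨ cong₂ _+_ (coeff-newton-≥ L s L ℕ.≤-refl) (trans (coeff-*ᵖ (fromℕ (s L)) (binomial L) L)
        (cong (fromℕ (s L) *_) (coeff-binomial L))) ⟩
  0ℚ + fromℕ (s L) * inv (fromℕ (L !))
    ≡⟨ ℚ.+-identityˡ _ ⟩
  fromℕ (s L) * inv (fromℕ (L !)) ∎
  where open ≡-Reasoning

corollary1p2 : ∀ (k : ℕ) → 1 ≤ k →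
    ∃[ p ] (HasDegree p ((k ℕ.+ 1) C 2)
    × coeff p ((k ℕ.+ 1) C 2) ≡ ∏ k (λ i → (2 ℕ.* i) !/ (k ℕ.+ i) !)
    × (∀ n → k ≤ n → ∃[ N ] (NumberOf (IsASM {k} {n}) N × eval p (fromℕ n) ≡ fromℕ N)))
corollary1p2 k _ = newton (suc N) S , subst (HasDegree _) degree hasDegree
  , trans (cong (coeff (newton (suc N) S)) (sym degree)) leading
  , λ n _ → completions n (empty {k}) , NumberOf-IsASM k n
  , trans (eval-newton (suc N) S n) (cong fromℕ (sym (completions-newton n empty)))
  where
  open ≡-Reasoning
  N = weight 1 (empty {k})
  S : ℕ → ℕ
  S m = chains m (empty {k})
  degree : N ≡ (k ℕ.+ 1) C 2
  -- The case `a = 0`, where the added term `1 C 2` computes to 0.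
  degree = trans (sym (ℕ.+-identityʳ N)) (trans (weight-empty k 0) (cong (_C 2) (ℕ.+-comm 1 k)))
  leading : coeff (newton (suc N) S) N ≡ ∏ k (λ i → (2 ℕ.* i) !/ (k ℕ.+ i) !)
  leading = begin
    coeff (newton (suc N) S) N                                        ≡⟨ coeff-newton N S ⟩
    fromℕ (S N) * inv (fromℕ (N !))
      ≡⟨ cong (_* inv (fromℕ (N !))) (chains-hook N empty refl) ⟩
    fromℕ (N !) * hook (zeros 1 (empty {k})) * inv (fromℕ (N !))
      ≡⟨ e (fromℕ (N !)) (hook (zeros 1 (empty {k}))) (inv (fromℕ (N !))) ⟩
    fromℕ (N !) * inv (fromℕ (N !)) * hook (zeros 1 (empty {k}))
      ≡⟨ cong (_* hook (zeros 1 (empty {k}))) (inv-cancel (fromℕ-!≢0 N)) ⟩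
    1ℚ * hook (zeros 1 (empty {k}))                                   ≡⟨ ℚ.*-identityˡ _ ⟩
    hook (zeros 1 (empty {k}))                                        ≡⟨ hook-empty k ⟩
    ∏ k (λ i → (2 ℕ.* i) !/ (k ℕ.+ i) !)                              ∎
    where
    e : ∀ a b c → a * b * c ≡ a * c * b
    e = solve-∀ ℚ-ring
  hasDegree : HasDegree (newton (suc N) S) N
  hasDegree = record
    -- Every factor of the leading coefficient is a quotient of factorials and hence non-zero.
    { coeff-d≢0 = λ eq → ∏≢0 k (λ i → (2 ℕ.* i) !/ (k ℕ.+ i) !) (λ i → !/!≢0 (2 ℕ.* i) (k ℕ.+ i))
        (trans (sym leading) eq)
    ; coeff>d≡0 = coeff-newton-≥ (suc N) S
    }
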